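{- Let $H$ be a triangle-free graph with vertex set $[h]$. There exists a constant $\beta_H>0$ such that the following holds for all $0<\gamma\leq\frac12$ and all positive integers $n$. Let $G$ be a graph and let $V_1,\dots,V_h\subseteq V(G)$ form a $(\gamma,\geq n)$-inflation of $H$. Then there exist a positive integer $k\geq \beta_H\frac{\log n}{\log(1/\gamma)}$ and subsets $W_i\subseteq V_i$ with $|W_i|=k$ for all $i\in[h]$ which form a copy of $H[k]$, i.e. every vertex of $W_i$ is adjacent in $G$ to every vertex of $W_j$ whenever $ij\in E(H)$. In particular $H[k]\subseteq G$.
   Context: For a graph $H$ and a positive integer $k$, $H[k]$ is the graph obtained from $H$ by replacing each vertex by an independent set of size $k$ and each edge by a $K_{k,k}$. For pairwise disjoint $V_1,\dots,V_h\subseteq V(G)$, a canonical copy of $H$ is a tuple $(v_1,\dots,v_h)$ with $v_i\in V_i$ such that $v_iv_j\in E(G)$ whenever $ij\in E(H)$. $(V_1,\dots,V_h)$ is a $(\gamma,\geq n)$-inflation of $H$ if $|V_i|\geq n$ for all $i$ and it contains at least $\gamma\prod_{i=1}^h|V_i|$ canonical copies of $H$. Logarithms are to base $2$. -}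

module Defs where

open import Algebra.Definitions.RawSemiring using () renaming (_^_ to pow)
open import Data.Empty using (⊥)
open import Data.Fin using (Fin)
open import Data.Fin.Properties using (all?)
open import Data.Fin.Subset using (Subset; _∈_; _∩_; Empty; ∣_∣)
open import Data.Fin.Subset.Properties using (_∈?_)
open import Data.Integer as ℤ using (ℤ; +_; -[1+_])
open import Data.List using (List; []; _∷_; allFin; cartesianProductWith; filter; length; tabulate)
open import Data.Nat as ℕ using (ℕ; zero; suc)
open import Data.Nat.ListAction using (product)
open import Data.Product using (∃-syntax; _×_; _,_; proj₁)
open import Data.Rational as ℚ using (ℚ; 0ℚ; 1ℚ; ½)
open import Data.Sum using (_⊎_)
open import Data.Vec using (Vec; []; _∷_; lookup)
open import Function.Base using (_on_)
open import Function.Definitions using (Injective)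
open import Relation.Binary.Core using (Rel)
open import Relation.Binary.Definitions using (Decidable; Irreflexive; Symmetric)
open import Relation.Binary.PropositionalEquality using (_≡_; _≢_; refl)
open import Relation.Nullary using (Dec; ¬_)
open import Relation.Nullary.Decidable using (_×-dec_; _→-dec_)
open import Level using (0ℓ)

infixr 8 _^_
infix  8 _⁻¹
infixl 7 _*_ _/_
infix  4 _<_ _≤_

-- A real number is a (two-sided, located) Dedekind cut of ℚ.  The operations
-- below are defined on arbitrary pairs of predicates, so that they can be
-- written down without a proof of IsReal for each result; on cuts satisfying
-- IsReal (and the sign conditions stated) they are the usual operations.

record Cut : Set₁ where
  field
    Lower : ℚ → Set    -- Lower q  means  q < x
    Upper : ℚ → Set    -- Upper q  means  x < q

open Cut public

record IsReal (x : Cut) : Set where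
  field
    inhabitedˡ : ∃[ q ] Lower x q
    inhabitedᵘ : ∃[ q ] Upper x q
    closedˡ    : ∀ {q r} → q ℚ.< r → Lower x r → Lower x q
    closedᵘ    : ∀ {q r} → q ℚ.< r → Upper x q → Upper x r
    openˡ      : ∀ {q} → Lower x q → ∃[ r ] q ℚ.< r × Lower x r
    openᵘ      : ∀ {r} → Upper x r → ∃[ q ] q ℚ.< r × Upper x q
    disjoint   : ∀ {q} → ¬ (Lower x q × Upper x q)
    located    : ∀ {q r} → q ℚ.< r → Lower x q ⊎ Upper x r

_<_ : Cut → Cut → Set
x < y = ∃[ q ] Upper x q × Lower y q

_≤_ : Cut → Cut → Set
x ≤ y = ∀ q → Lower x q → Lower y q

fromℚ : ℚ → Cut
fromℚ p = record { Lower = λ q → q ℚ.< p ; Upper = λ q → p ℚ.< q }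

fromℕ : ℕ → Cut
fromℕ n = fromℚ (+ n ℚ./ 1)

-- Interval multiplication: for a < x < b and c < y < d the product x * y lies
-- between the least and the greatest of ac, ad, bc, bd.
_*_ : Cut → Cut → Cut
x * y = record
  { Lower = λ q → ∃[ a ] ∃[ b ] ∃[ c ] ∃[ d ] Encloses a b c d ×
      q ℚ.< a ℚ.* c × q ℚ.< a ℚ.* d × q ℚ.< b ℚ.* c × q ℚ.< b ℚ.* d
  ; Upper = λ q → ∃[ a ] ∃[ b ] ∃[ c ] ∃[ d ] Encloses a b c d ×
      a ℚ.* c ℚ.< q × a ℚ.* d ℚ.< q × b ℚ.* c ℚ.< q × b ℚ.* d ℚ.< q
  }
  where
  Encloses : ℚ → ℚ → ℚ → ℚ → Set
  Encloses a b c d = Lower x a × Upper x b × Lower y c × Upper y d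

-- Meaningful for x > 0 only.  Then every rational d in the upper cut is
-- positive, and q < 1/x iff q * d < 1 for some rational d > x.
_⁻¹ : Cut → Cut
x ⁻¹ = record
  { Lower = λ q → ∃[ d ] Upper x d × q ℚ.* d ℚ.< 1ℚ
  ; Upper = λ q → ∃[ c ] Lower x c × 0ℚ ℚ.< c × 1ℚ ℚ.< q ℚ.* c
  }

-- Meaningful for y > 0 only.
_/_ : Cut → Cut → Cut
x / y = x * y ⁻¹

_^_ : ℚ → ℕ → ℚ
_^_ = pow ℚ.+-*-rawSemiring

2^_ : ℤ → ℚ
2^ (+ n)    = (+ 2 ℚ./ 1) ^ n
2^ -[1+ n ] = ½ ^ suc n

-- Logarithm to base 2, meaningful for x > 0 only.  For q = s / t with t > 0,
-- q < log₂ x  iff  2 ^ s < x ^ t.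
log₂ : Cut → Cut
log₂ x = record
  { Lower = λ q → ∃[ a ] Lower x a × 0ℚ ℚ.< a × 2^ (ℚ.↥ q) ℚ.< a ^ ℚ.↧ₙ q
  ; Upper = λ q → ∃[ b ] Upper x b × b ^ ℚ.↧ₙ q ℚ.< 2^ (ℚ.↥ q)
  }

-- Simple graphs.  Adjacency is required to be decidable, which is automatic
-- for finite graphs classically and lets canonical copies be counted.
record Graph (V : Set) : Set₁ where
  field
    Adj    : Rel V 0ℓ
    sym    : Symmetric Adj
    irrefl : Irreflexive _≡_ Adj
    adj?   : Decidable Adj

open Graph public using (Adj; adj?)

TriangleFree : ∀ {V} → Graph V → Set
TriangleFree H = ∀ x y z → Adj H x y → Adj H y z → Adj H x z → ⊥

-- The blow-up H[k]: the copies of v are the pairs (v , a).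
_[_] : ∀ {V} → Graph V → (k : ℕ) → Graph (V × Fin k)
H [ k ] = record
  { Adj    = Adj H on proj₁
  ; sym    = Graph.sym H
  ; irrefl = λ { refl → Graph.irrefl H refl }
  ; adj?   = λ x y → adj? H (proj₁ x) (proj₁ y)
  }

-- Subgraph containment up to isomorphism (not necessarily induced).
_⊑_ : ∀ {U V} → Graph U → Graph V → Set
_⊑_ {U} {V} F G = ∃[ f ] Injective {A = U} {B = V} _≡_ _≡_ f ×
                          (∀ {x y} → Adj F x y → Adj G (f x) (f y))

module _ {h N : ℕ} (H : Graph (Fin h)) (G : Graph (Fin N)) (V : Fin h → Subset N) where

  IsCanonicalCopy : Vec (Fin N) h → Set
  IsCanonicalCopy v = (∀ i → lookup v i ∈ V i) ×
                      (∀ i j → Adj H i j → Adj G (lookup v i) (lookup v j))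

  isCanonicalCopy? : ∀ v → Dec (IsCanonicalCopy v)
  isCanonicalCopy? v =
    all? (λ i → lookup v i ∈? V i) ×-dec
    all? (λ i → all? (λ j → adj? H i j →-dec adj? G (lookup v i) (lookup v j)))

-- All h-tuples of entries of xs, each exactly once if xs has no repetitions.
tuples : ∀ {A : Set} (h : ℕ) → List A → List (Vec A h)
tuples zero    xs = [] ∷ []
tuples (suc h) xs = cartesianProductWith _∷_ xs (tuples h xs)

#canonicalCopies : ∀ {h N} → Graph (Fin h) → Graph (Fin N) → (Fin h → Subset N) → ℕ
#canonicalCopies {h} {N} H G V =
  length (filter (isCanonicalCopy? H G V) (tuples h (allFin N)))

record IsInflation {h N : ℕ} (γ : Cut) (n : ℕ) (H : Graph (Fin h)) (G : Graph (Fin N))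
                   (V : Fin h → Subset N) : Set where
  field
    disjoint : ∀ i j → i ≢ j → Empty (V i ∩ V j)
    large    : ∀ i → n ℕ.≤ ∣ V i ∣
    copies   : γ * fromℕ (product (tabulate (λ i → ∣ V i ∣))) ≤ fromℕ (#canonicalCopies H G V)

module Submission where

-- Process the vertices s of H one at a time.  Split a tuple into its part x on the
-- neighbourhood N(s) and its part c off N(s).  Since H is triangle-free, N(s) is
-- independent, so the x that form canonical copies with each of c₁, …, c_k fill a
-- product of sets V′ᵢ.  If canonical copies have density 2^-g, choose the c's at
-- random: an x compatible with a fraction of at least 2^-(g+1) of all c survives
-- with probability at least 2^-(g+2)k, even if the s-coordinates of the c's are
-- forced to be distinct, whereas an x compatible with a fraction below 2^-(2g+4)
-- survives with probability at most 2^-(2g+4)k.  Hence some choice leaves sets V′ᵢ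
-- of relative size at least 2^-(2g+4)k in which copies have density at least
-- 2^-(2g+5), with no loss depending on k, and every V′ᵢ with i ∈ N(s) is completely
-- joined to the set W_s of s-coordinates of the c's.  The h rounds together spend
-- only O_H(gk) from log n.

-- The obstacle is the density. If a round lowered it to 2^-O(gk), the next round would cost gk² and
-- h rounds would need log n of order gk^h. Counting survivors alone does not exclude this, since
-- most of them could extend to few copies. So rich and poor x are followed in a single potential.
-- With D = 2^g and α = 4D, a rich x survives one choice with probability at least 1/α, a poor one
-- with probability at most 1/β = 1/α². The 4 consists of two halvings: averaging makes x rich at
-- the threshold 1/(2D), and forcing distinct s-coordinates costs another half. The rates differ by
-- the factor α, so even P poor x against P/(2D) rich ones (P being the number of all tuples) are
-- outweighed after one choice. The resulting inequality bounds the survivors from below and at the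
-- same time the poor survivors by the rich ones. A real γ cannot be compared exactly with powers of
-- 2. It is only located by 2^-(m+2) < γ ≤ 2^-m, and two more halvings in reading off the number of
-- copies lead to g = m + 4.

open import Data.Fin as Fin using (Fin; zero; suc)
import Data.Fin.Properties as Fin
open import Data.Nat as ℕ using (ℕ; zero; suc)
import Data.Nat.Properties as ℕ
open import Data.Nat.Tactic.RingSolver using (solve-∀)
open import Data.Product using (∃-syntax; Σ-syntax; _×_; _,_; proj₁; proj₂)
open import Data.Sum using (_⊎_; inj₁; inj₂)
open import Function using (_∘_; const; id)
open import Relation.Binary.PropositionalEquality using (_≡_; _≢_; refl; sym; trans; cong; cong₂; subst; subst₂; module ≡-Reasoning)
open import Relation.Nullary using (Dec; yes; no; ¬_; does; contradiction)
open import Relation.Nullary.Decidable using (¬?; _→-dec_; dec-true; dec-false)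

-- Finite sums, indicators and boxes of tuples.

module Counting where

  open import Data.List using (List; []; _∷_; _++_; map; filter; length; tabulate; cartesianProductWith)
  open import Data.List.Membership.Propositional using (_∈_)
  open import Data.List.Membership.Propositional.Properties using (∈-cartesianProductWith⁻)
  open import Data.List.Properties using (map-++)
  open import Data.List.Relation.Unary.Any using (here; there)
  open import Data.Nat
  open import Data.Nat.ListAction using (sum; product)
  open import Data.Nat.ListAction.Properties using (sum-++)
  open import Data.Nat.Properties
  open import Data.Bool using (Bool; true; false; if_then_else_)
  open import Data.Vec using (Vec; []; _∷_; lookup)
  open import Relation.Unary using (Decidable)
  open import Defs using (tuples)

  private variable
    A B C : Set
    P Q : Set

  n<2^n : ∀ n → n < 2 ^ n
  n<2^n zero    = z<s
  n<2^n (suc n) = ≤-trans (s≤s (n<2^n n)) (+-mono-≤ (m^n>0 2 n) (m≤m+n (2 ^ n) 0))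

  ∑ : List A → (A → ℕ) → ℕ
  ∑ xs f = sum (map f xs)

  ∑-mono : ∀ (xs : List A) {f g} → (∀ {x} → x ∈ xs → f x ≤ g x) → ∑ xs f ≤ ∑ xs g
  ∑-mono []       f≤g = z≤n
  ∑-mono (x ∷ xs) f≤g = +-mono-≤ (f≤g (here refl)) (∑-mono xs (f≤g ∘ there))

  ∑-cong : ∀ (xs : List A) {f g} → (∀ {x} → x ∈ xs → f x ≡ g x) → ∑ xs f ≡ ∑ xs g
  ∑-cong []       f≡g = refl
  ∑-cong (x ∷ xs) f≡g = cong₂ _+_ (f≡g (here refl)) (∑-cong xs (f≡g ∘ there))

  ∑-+ : ∀ (xs : List A) f g → ∑ xs (λ x → f x + g x) ≡ ∑ xs f + ∑ xs g
  ∑-+ []       f g = refl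
  ∑-+ (x ∷ xs) f g rewrite ∑-+ xs f g = interchange (f x) (g x) _ _
    where
    interchange : ∀ a b c d → a + b + (c + d) ≡ a + c + (b + d)
    interchange = solve-∀

  ∑-* : ∀ (xs : List A) m f → ∑ xs (λ x → m * f x) ≡ m * ∑ xs f
  ∑-* []       m f = sym (*-zeroʳ m)
  ∑-* (x ∷ xs) m f rewrite ∑-* xs m f = sym (*-distribˡ-+ m (f x) _)

  ∑-const : ∀ (xs : List A) m → ∑ xs (const m) ≡ length xs * m
  ∑-const []       m = refl
  ∑-const (x ∷ xs) m = cong (m +_) (∑-const xs m)

  ∑-swap : ∀ (xs : List A) (ys : List B) (f : A → B → ℕ) →
           ∑ xs (λ x → ∑ ys (f x)) ≡ ∑ ys (λ y → ∑ xs (λ x → f x y))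
  ∑-swap []       ys f = sym (trans (∑-const ys 0) (*-zeroʳ (length ys)))
  ∑-swap (x ∷ xs) ys f rewrite ∑-swap xs ys f = sym (∑-+ ys (f x) _)

  ∑-++ : ∀ (xs ys : List A) f → ∑ (xs ++ ys) f ≡ ∑ xs f + ∑ ys f
  ∑-++ xs ys f = trans (cong sum (map-++ f xs ys)) (sum-++ (map f xs) _)

  ∑-map : ∀ (g : A → B) xs f → ∑ (map g xs) f ≡ ∑ xs (f ∘ g)
  ∑-map g []       f = refl
  ∑-map g (x ∷ xs) f = cong (f (g x) +_) (∑-map g xs f)

  ∑-cartesianProductWith : ∀ (_•_ : A → B → C) xs ys f →
    ∑ (cartesianProductWith _•_ xs ys) f ≡ ∑ xs (λ x → ∑ ys (λ y → f (x • y)))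
  ∑-cartesianProductWith _•_ []       ys f = refl
  ∑-cartesianProductWith _•_ (x ∷ xs) ys f =
    trans (∑-++ (map (x •_) ys) _ f)
          (cong₂ _+_ (∑-map (x •_) ys f) (∑-cartesianProductWith _•_ xs ys f))

  -- The averaging principle that makes random choices deterministic: an inequality between
  -- expectations holds at some outcome.
  ∑≤∑⇒∃≤ : ∀ (xs : List A) {f g} → 0 < length xs → ∑ xs f ≤ ∑ xs g → ∃[ x ] x ∈ xs × f x ≤ g x
  ∑≤∑⇒∃≤ (x ∷ xs) {f} {g} _ ∑f≤∑g with f x ≤? g x
  ... | yes fx≤gx = x , here refl , fx≤gx
  ∑≤∑⇒∃≤ (x ∷ []) {f} {g} _ ∑f≤∑g | no fx≰gx =
    contradiction (+-cancelʳ-≤ 0 (f x) (g x) ∑f≤∑g) fx≰gx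
  ∑≤∑⇒∃≤ (x ∷ xs@(_ ∷ _)) {f} {g} _ ∑f≤∑g | no fx≰gx
    with y , y∈xs , fy≤gy ← ∑≤∑⇒∃≤ xs {f} {g} z<s
           (+-cancelˡ-≤ (g x) _ _ (≤-trans (+-monoˡ-≤ _ (<⇒≤ (≰⇒> fx≰gx))) ∑f≤∑g))
    = y , there y∈xs , fy≤gy

  ∑>0⇒∃>0 : ∀ (xs : List A) f → 0 < ∑ xs f → ∃[ x ] x ∈ xs × 0 < f x
  ∑>0⇒∃>0 (x ∷ xs) f 0<∑ with f x in eq
  ... | suc _ = x , here refl , subst (0 <_) (sym eq) z<s
  ... | zero with y , y∈xs , 0<fy ← ∑>0⇒∃>0 xs f 0<∑ = y , there y∈xs , 0<fy

  ι : Dec P → ℕ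
  ι p? = if does p? then 1 else 0

  ι≤1 : (p? : Dec P) → ι p? ≤ 1
  ι≤1 (yes _) = ≤-refl
  ι≤1 (no _)  = z≤n

  ι-yes : (p? : Dec P) → P → ι p? ≡ 1
  ι-yes (yes _) p = refl
  ι-yes (no ¬p) p = contradiction p ¬p

  ι-no : (p? : Dec P) → ¬ P → ι p? ≡ 0
  ι-no (yes p) ¬p = contradiction p ¬p
  ι-no (no _)  ¬p = refl

  ι-mono : (p? : Dec P) (q? : Dec Q) → (P → Q) → ι p? ≤ ι q?
  ι-mono (no _)  q? f = z≤n
  ι-mono (yes p) q? f = ≤-reflexive (sym (ι-yes q? (f p)))

  ι-cong : (p? : Dec P) (q? : Dec Q) → (P → Q) → (Q → P) → ι p? ≡ ι q?
  ι-cong p? q? f g = ≤-antisym (ι-mono p? q? f) (ι-mono q? p? g)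

  ι-× : {R : Set} (p? : Dec P) (q? : Dec Q) (r? : Dec R) → (P → Q → R) → (R → P × Q) →
        ι p? * ι q? ≡ ι r?
  ι-× (yes p) q? r? f g = trans (+-identityʳ _) (ι-cong q? r? (f p) (proj₂ ∘ g))
  ι-× (no ¬p) q? r? f g = sym (ι-no r? (¬p ∘ proj₁ ∘ g))

  ι-≤ : ∀ {n} (p? : Dec P) → (P → 0 < n) → ι p? ≤ n
  ι-≤ (yes p) 0<n = 0<n p
  ι-≤ (no _)  0<n = z≤n

  ι-*-mono : ∀ {m n} (p? : Dec P) → (P → m ≤ n) → ι p? * m ≤ ι p? * n
  ι-*-mono (yes p) m≤n = *-monoʳ-≤ 1 (m≤n p)
  ι-*-mono (no _)  m≤n = z≤n

  ι-*-elim : ∀ {n} (p? : Dec P) → 0 < ι p? * n → P × 0 < n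
  ι-*-elim (yes p) 0<n = p , subst (0 <_) (+-identityʳ _) 0<n

  ι-either : ∀ {m n l} (p? : Dec P) → (P → m ≤ n) → (¬ P → m ≤ l) → m ≤ n * ι p? + l
  ι-either (yes p) m≤n m≤l = ≤-trans (m≤n p) (≤-trans (≤-reflexive (sym (*-identityʳ _))) (m≤m+n _ _))
  ι-either (no ¬p) m≤n m≤l = ≤-trans (m≤l ¬p) (m≤n+m _ _)

  ι-¬-cover : ∀ {n} (p? : Dec P) → n ≤ 1 → n ≤ ι (¬? p?) * n + ι p?
  ι-¬-cover (yes _) n≤1 = n≤1
  ι-¬-cover (no _)  n≤1 = ≤-reflexive (sym (trans (+-identityʳ _) (+-identityʳ _)))

  ι-cover : ∀ n (p? : Dec P) (q? : Dec Q) → (¬ P → Q) → n ≤ ι p? * n + ι q? * n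
  ι-cover n (yes _) q? f = ≤-trans (≤-reflexive (sym (*-identityˡ n))) (m≤m+n _ _)
  ι-cover n (no ¬p) q? f = ≤-reflexive (sym (trans (cong (_* n) (ι-yes q? (f ¬p))) (*-identityˡ n)))

  ∑-filter : ∀ {P : A → Set} (P? : Decidable P) xs f → ∑ (filter P? xs) f ≡ ∑ xs (λ x → ι (P? x) * f x)
  ∑-filter P? []       f = refl
  ∑-filter P? (x ∷ xs) f with P? x
  ... | yes _ = cong₂ _+_ (sym (+-identityʳ _)) (∑-filter P? xs f)
  ... | no  _ = ∑-filter P? xs f

  length≡∑ : ∀ (xs : List A) → length xs ≡ ∑ xs (const 1)
  length≡∑ xs = sym (trans (∑-const xs 1) (*-identityʳ _))

  length-filter≡∑ : ∀ {P : A → Set} (P? : Decidable P) xs → length (filter P? xs) ≡ ∑ xs (λ x → ι (P? x))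
  length-filter≡∑ P? xs = trans (length≡∑ (filter P? xs))
    (trans (∑-filter P? xs (const 1)) (∑-cong xs λ _ → *-identityʳ _))

  box : ∀ {h} → (Fin h → List A) → List (Vec A h)
  box {h = zero}  V = [] ∷ []
  box {h = suc h} V = cartesianProductWith _∷_ (V zero) (box (V ∘ suc))

  tuples≡box : ∀ h (xs : List A) → tuples h xs ≡ box {h = h} (const xs)
  tuples≡box zero    xs = refl
  tuples≡box (suc h) xs = cong (cartesianProductWith _∷_ xs) (tuples≡box h xs)

  ∑-box : ∀ {h} (V : Fin (suc h) → List A) f →
          ∑ (box V) f ≡ ∑ (V zero) (λ a → ∑ (box (V ∘ suc)) (λ x → f (a ∷ x)))
  ∑-box V f = ∑-cartesianProductWith _∷_ (V zero) _ f

  length-box : ∀ {h} (V : Fin h → List A) → length (box V) ≡ product (tabulate (length ∘ V))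
  length-box {h = zero}  V = refl
  length-box {h = suc h} V = begin
    length (box V)                                     ≡⟨ length≡∑ (box V) ⟩
    ∑ (box V) (const 1)                                ≡⟨ ∑-box V (const 1) ⟩
    ∑ (V zero) (const (∑ (box (V ∘ suc)) (const 1)))   ≡⟨ ∑-const (V zero) _ ⟩
    length (V zero) * ∑ (box (V ∘ suc)) (const 1)      ≡⟨ cong (length (V zero) *_) (length≡∑ (box (V ∘ suc))) ⟨
    length (V zero) * length (box (V ∘ suc))           ≡⟨ cong (length (V zero) *_) (length-box (V ∘ suc)) ⟩
    length (V zero) * product (tabulate (length ∘ V ∘ suc)) ∎
    where open ≡-Reasoning

  ∈-box⁻ : ∀ {h} (V : Fin h → List A) {x} → x ∈ box V → ∀ i → lookup x i ∈ V i
  ∈-box⁻ {h = suc h} V x∈ i with ∈-cartesianProductWith⁻ _∷_ (V zero) (box (V ∘ suc)) x∈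
  ∈-box⁻ {h = suc h} V x∈ zero    | a , y , a∈ , y∈ , refl = a∈
  ∈-box⁻ {h = suc h} V x∈ (suc i) | a , y , a∈ , y∈ , refl = ∈-box⁻ (V ∘ suc) y∈ i

  -- Lets a sum over a shrunken box be taken over the original box with an indicator weight, so that
  -- all counting happens on one index list.
  ∑-box-filter : ∀ {h} (V : Fin h → List A) {Q : Fin h → A → Set} (Q? : ∀ i → Decidable (Q i)) f →
    ∑ (box (λ i → filter (Q? i) (V i))) f ≡ ∑ (box V) (λ x → ι (Fin.all? λ i → Q? i (lookup x i)) * f x)
  ∑-box-filter {h = zero}  V Q? f = sym (cong (_+ 0) (+-identityʳ (f [])))
  ∑-box-filter {h = suc h} V Q? f = begin
    ∑ (box (λ i → filter (Q? i) (V i))) f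
      ≡⟨ ∑-box (λ i → filter (Q? i) (V i)) f ⟩
    ∑ (filter (Q? zero) (V zero)) (λ a → ∑ (box (λ i → filter (Q? (suc i)) (V (suc i)))) (λ x → f (a ∷ x)))
      ≡⟨ ∑-cong (filter (Q? zero) (V zero)) (λ {a} _ → ∑-box-filter (V ∘ suc) (Q? ∘ suc) (λ x → f (a ∷ x))) ⟩
    ∑ (filter (Q? zero) (V zero)) (λ a → ∑ (box (V ∘ suc)) (λ x → tail? x * f (a ∷ x)))
      ≡⟨ ∑-filter (Q? zero) (V zero) _ ⟩
    ∑ (V zero) (λ a → ι (Q? zero a) * ∑ (box (V ∘ suc)) (λ x → tail? x * f (a ∷ x)))
      ≡⟨ ∑-cong (V zero) (λ {a} _ → trans (sym (∑-* (box (V ∘ suc)) (ι (Q? zero a)) _))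
           (∑-cong (box (V ∘ suc)) λ {x} _ → trans (sym (*-assoc (ι (Q? zero a)) _ _)) (cong (_* f (a ∷ x)) (split a x)))) ⟩
    ∑ (V zero) (λ a → ∑ (box (V ∘ suc)) (λ x → ι (Fin.all? λ i → Q? i (lookup (a ∷ x) i)) * f (a ∷ x)))
      ≡⟨ ∑-box V _ ⟨
    ∑ (box V) (λ x → ι (Fin.all? λ i → Q? i (lookup x i)) * f x) ∎
    where
    open ≡-Reasoning
    tail? : Vec _ h → ℕ
    tail? x = ι (Fin.all? λ i → Q? (suc i) (lookup x i))
    split : ∀ a x → ι (Q? zero a) * tail? x ≡ ι (Fin.all? λ i → Q? i (lookup (a ∷ x) i))
    split a x = ι-× (Q? zero a) (Fin.all? λ i → Q? (suc i) (lookup x i)) (Fin.all? λ i → Q? i (lookup (a ∷ x) i))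
      (λ q qs → λ { zero → q ; (suc i) → qs i }) (λ qs → qs zero , qs ∘ suc)

  -- In the quotient of the two products every factor other than the j-th is at most 1. For boxes:
  -- the relative size of a sub-box is at most that of each of its sides, so a large sub-box has
  -- only large sides.
  product-ratio : ∀ {h} (a b : Fin h → ℕ) → (∀ i → a i ≤ b i) → ∀ j →
                  product (tabulate a) * b j ≤ a j * product (tabulate b)
  product-ratio {suc h} a b a≤b zero = begin
    a zero * product (tabulate (a ∘ suc)) * b zero   ≤⟨ *-monoˡ-≤ (b zero) (*-monoʳ-≤ (a zero) (product-mono (a ∘ suc) (b ∘ suc) (a≤b ∘ suc))) ⟩
    a zero * product (tabulate (b ∘ suc)) * b zero   ≡⟨ rearrange (a zero) _ (b zero) ⟩
    a zero * (b zero * product (tabulate (b ∘ suc))) ∎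
    where
    open ≤-Reasoning
    rearrange : ∀ x y z → x * y * z ≡ x * (z * y)
    rearrange = solve-∀
    product-mono : ∀ {h} (a b : Fin h → ℕ) → (∀ i → a i ≤ b i) → product (tabulate a) ≤ product (tabulate b)
    product-mono {zero}  a b a≤b = ≤-refl
    product-mono {suc h} a b a≤b = *-mono-≤ (a≤b zero) (product-mono (a ∘ suc) (b ∘ suc) (a≤b ∘ suc))
  product-ratio {suc h} a b a≤b (suc j) = begin
    a zero * product (tabulate (a ∘ suc)) * b (suc j)    ≡⟨ *-assoc (a zero) _ _ ⟩
    a zero * (product (tabulate (a ∘ suc)) * b (suc j))  ≤⟨ *-mono-≤ (a≤b zero) (product-ratio (a ∘ suc) (b ∘ suc) (a≤b ∘ suc) j) ⟩
    b zero * (a (suc j) * product (tabulate (b ∘ suc)))  ≡⟨ rearrange (b zero) (a (suc j)) _ ⟩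
    a (suc j) * (b zero * product (tabulate (b ∘ suc)))  ∎
    where
    open ≤-Reasoning
    rearrange : ∀ x y z → x * (y * z) ≡ y * (x * z)
    rearrange = solve-∀

  -- The parts of a tuple on and off a mask are represented by full tuples, of which only the
  -- coordinates on one side of the mask are read. This avoids splitting a box into two boxes of
  -- mask-dependent shape; counts merely gain a factor `length (box V)`.
  merge : ∀ {h} → Vec Bool h → Vec A h → Vec A h → Vec A h
  merge []          []      []      = []
  merge (true  ∷ m) (a ∷ x) (b ∷ y) = a ∷ merge m x y
  merge (false ∷ m) (a ∷ x) (b ∷ y) = b ∷ merge m x y

  lookup-merge-true : ∀ {h} (m : Vec Bool h) (x y : Vec A h) i → lookup m i ≡ true →
                      lookup (merge m x y) i ≡ lookup x i
  lookup-merge-true (true  ∷ m) (a ∷ x) (b ∷ y) zero    eq = refl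
  lookup-merge-true (true  ∷ m) (a ∷ x) (b ∷ y) (suc i) eq = lookup-merge-true m x y i eq
  lookup-merge-true (false ∷ m) (a ∷ x) (b ∷ y) (suc i) eq = lookup-merge-true m x y i eq

  lookup-merge-false : ∀ {h} (m : Vec Bool h) (x y : Vec A h) i → lookup m i ≡ false →
                       lookup (merge m x y) i ≡ lookup y i
  lookup-merge-false (false ∷ m) (a ∷ x) (b ∷ y) zero    eq = refl
  lookup-merge-false (true  ∷ m) (a ∷ x) (b ∷ y) (suc i) eq = lookup-merge-false m x y i eq
  lookup-merge-false (false ∷ m) (a ∷ x) (b ∷ y) (suc i) eq = lookup-merge-false m x y i eq

  -- Exchanging the coordinates of `x` and `y` where the mask is `false` is an involution on pairs
  -- of tuples of the box, so it only permutes the summands.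
  ∑-merge : ∀ {h} (V : Fin h → List A) (m : Vec Bool h) (F : Vec A h → Vec A h → ℕ) →
    ∑ (box V) (λ x → ∑ (box V) (λ y → F (merge m x y) (merge m y x))) ≡
    ∑ (box V) (λ x → ∑ (box V) (F x))
  ∑-merge {h = zero}  V []      F = refl
  ∑-merge {h = suc h} V (t ∷ m) F = begin
    ∑ (box V) (λ x → ∑ (box V) (λ y → F (merge (t ∷ m) x y) (merge (t ∷ m) y x)))
      ≡⟨ expand (λ x y → F (merge (t ∷ m) x y) (merge (t ∷ m) y x)) ⟩
    ∑ V₀ (λ a → ∑ V₀ (λ b → ∑ V₊ (λ x → ∑ V₊ (λ y →
      F (merge (t ∷ m) (a ∷ x) (b ∷ y)) (merge (t ∷ m) (b ∷ y) (a ∷ x))))))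
      ≡⟨ by-head t ⟩
    ∑ V₀ (λ a → ∑ V₀ (λ b → ∑ V₊ (λ x → ∑ V₊ (λ y → F (a ∷ x) (b ∷ y)))))
      ≡⟨ expand F ⟨
    ∑ (box V) (λ x → ∑ (box V) (F x)) ∎
    where
    open ≡-Reasoning
    V₀ = V zero
    V₊ = box (V ∘ suc)
    expand : ∀ K → ∑ (box V) (λ x → ∑ (box V) (K x)) ≡
                   ∑ V₀ (λ a → ∑ V₀ (λ b → ∑ V₊ (λ x → ∑ V₊ (λ y → K (a ∷ x) (b ∷ y)))))
    expand K = trans (∑-box V _) (∑-cong V₀ λ {a} _ →
      trans (∑-cong V₊ λ {x} _ → ∑-box V (K (a ∷ x))) (∑-swap V₊ V₀ _))
    by-head : ∀ t → ∑ V₀ (λ a → ∑ V₀ (λ b → ∑ V₊ (λ x → ∑ V₊ (λ y →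
      F (merge (t ∷ m) (a ∷ x) (b ∷ y)) (merge (t ∷ m) (b ∷ y) (a ∷ x)))))) ≡
      ∑ V₀ (λ a → ∑ V₀ (λ b → ∑ V₊ (λ x → ∑ V₊ (λ y → F (a ∷ x) (b ∷ y)))))
    by-head true  = ∑-cong V₀ λ {a} _ → ∑-cong V₀ λ {b} _ → ∑-merge (V ∘ suc) m (λ x y → F (a ∷ x) (b ∷ y))
    by-head false = trans
      (∑-cong V₀ λ {a} _ → ∑-cong V₀ λ {b} _ → ∑-merge (V ∘ suc) m (λ x y → F (b ∷ x) (a ∷ y)))
      (∑-swap V₀ V₀ (λ a b → ∑ V₊ (λ x → ∑ V₊ (λ y → F (b ∷ x) (a ∷ y)))))

module Blowups where

  open Counting
  open import Data.List as List using (List; []; _∷_; map; filter; length; tabulate; allFin)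
  import Data.List.Membership.DecPropositional as DecMembership
  open import Data.List.Membership.Propositional using (_∈_; _∉_)
  open import Data.List.Membership.Propositional.Properties using (∈-filter⁺; ∈-filter⁻; ∈-map⁻; ∈-allFin; ∈-lookup)
  open import Data.List.Properties using (length-map; length-filter; length-tabulate; map-tabulate; tabulate-cong; filter-all)
  open import Data.List.Relation.Unary.All as All using (All; []; _∷_)
  open import Data.List.Relation.Unary.AllPairs using ([]; _∷_)
  open import Data.List.Relation.Unary.Any using (here; there)
  open import Data.List.Relation.Unary.Unique.Propositional using (Unique)
  import Data.List.Relation.Unary.Unique.Propositional.Properties as Unique
  open import Data.Nat hiding (_≟_)
  open import Data.Nat.DivMod using (m≡m%n+[m/n]*n; m%n<n; m/n*n≤m)
  open import Data.Nat.ListAction using (product)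
  open import Data.Nat.Properties hiding (_≟_)
  open import Data.Bool as Bool using (Bool; true; false)
  open import Data.Vec as Vec using (Vec; []; _∷_; lookup; here; there)
  open import Data.Vec.Properties using (lookup∘tabulate; []=⇒lookup; lookup⇒[]=)
  open import Relation.Binary.Definitions using (DecidableEquality)
  open import Relation.Unary using (Decidable)
  open import Defs using (Graph; Adj; adj?; TriangleFree; _[_]; _⊑_; isCanonicalCopy?; #canonicalCopies; tuples)
  open import Data.Fin.Subset as Subset using (Subset; inside; outside; ∣_∣)
  import Data.Fin.Subset.Properties as Subset

  -- Derandomised choice of k elements with distinct keys.

  module Selection {X K : Set} (_≟_ : DecidableEquality K) (T : List X) (0<∣T∣ : 0 < length T)
                   (key : X → K) (ρ : X → X → ℕ) (α β κ : ℕ) where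

    open DecMembership _≟_ using (_∈?_)

    free : List K → X → ℕ
    free E c = ι (¬? (key c ∈? E))

    ρ* : List X → X → ℕ
    ρ* []       x = 1
    ρ* (c ∷ cs) x = ρ x c * ρ* cs x

    -- The weight on both sides restricts each inequality to the x of nonzero weight. There a
    -- uniform c is free and compatible with probability at least α/β (`Rich`), respectively
    -- compatible with probability at most 1/β (`Poor`). In this form both properties survive
    -- multiplying the weight by a further factor. `E` is quantified because the keys to avoid
    -- emerge only during the selection.
    Rich Poor : (X → ℕ) → Set
    Rich a = ∀ E → length E < κ → ∀ {x} → x ∈ T →
             a x * (α * length T) ≤ a x * (β * ∑ T (λ c → free E c * ρ x c))
    Poor b = ∀ {x} → x ∈ T → b x * (β * ∑ T (ρ x)) ≤ b x * length T

    private
      factor : ∀ (σ : X → X → ℕ) (γ : ℕ) (a : X → ℕ) →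
               ∑ T (λ c → γ * ∑ T (λ x → a x * σ x c)) ≡ ∑ T (λ x → a x * (γ * ∑ T (σ x)))
      factor σ γ a = begin
        ∑ T (λ c → γ * ∑ T (λ x → a x * σ x c))     ≡⟨ ∑-cong T (λ {c} _ → ∑-* T γ (λ x → a x * σ x c)) ⟨
        ∑ T (λ c → ∑ T (λ x → γ * (a x * σ x c)))   ≡⟨ ∑-swap T T _ ⟩
        ∑ T (λ x → ∑ T (λ c → γ * (a x * σ x c)))   ≡⟨ ∑-cong T (λ {x} _ → ∑-cong T λ {c} _ → rearrange γ (a x) (σ x c)) ⟩
        ∑ T (λ x → ∑ T (λ c → a x * (γ * σ x c)))   ≡⟨ ∑-cong T (λ {x} _ → trans (∑-* T (a x) _) (cong (a x *_) (∑-* T γ (σ x)))) ⟩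
        ∑ T (λ x → a x * (γ * ∑ T (σ x)))           ∎
        where
        open ≡-Reasoning
        rearrange : ∀ x y z → x * (y * z) ≡ y * (x * z)
        rearrange = solve-∀

      factor-const : ∀ (a : X → ℕ) m → ∑ T (λ x → a x * m) ≡ m * ∑ T a
      factor-const a m = trans (∑-cong T λ {x} _ → *-comm (a x) m) (∑-* T m a)

    -- Exchanging the sums over c and x turns the two hypotheses into bounds on averages over c. The
    -- weight `p` will be a power of α that accounts for the choices still to come.
    average : ∀ (σ : X → X → ℕ) p a b →
      (∀ {x} → x ∈ T → a x * (α * length T) ≤ a x * (β * ∑ T (σ x))) →
      (∀ {x} → x ∈ T → b x * (β * ∑ T (σ x)) ≤ b x * length T) →
      ∃[ c ] c ∈ T × p * (α * ∑ T a) + β * ∑ T (λ x → b x * σ x c)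
                   ≤ p * (β * ∑ T (λ x → a x * σ x c)) + ∑ T b
    average σ p a b a-rich b-poor = ∑≤∑⇒∃≤ T 0<∣T∣ (begin
      ∑ T (λ c → p * (α * ∑ T a) + β * ∑ T (λ x → b x * σ x c))
        ≡⟨ ∑-+ T _ _ ⟩
      ∑ T (λ c → p * (α * ∑ T a)) + ∑ T (λ c → β * ∑ T (λ x → b x * σ x c))
        ≡⟨ cong₂ _+_ (∑-const T _) (factor σ β b) ⟩
      length T * (p * (α * ∑ T a)) + ∑ T (λ x → b x * (β * ∑ T (σ x)))
        ≤⟨ +-monoʳ-≤ (length T * (p * (α * ∑ T a))) (∑-mono T b-poor) ⟩
      length T * (p * (α * ∑ T a)) + ∑ T (λ x → b x * length T)
        ≡⟨ cong₂ _+_ (rearrange (length T) p α _) (factor-const b (length T)) ⟩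
      p * (α * length T * ∑ T a) + length T * ∑ T b
        ≡⟨ cong (λ z → p * z + length T * ∑ T b) (factor-const a (α * length T)) ⟨
      p * ∑ T (λ x → a x * (α * length T)) + length T * ∑ T b
        ≤⟨ +-monoˡ-≤ (length T * ∑ T b) (*-monoʳ-≤ p (∑-mono T a-rich)) ⟩
      p * ∑ T (λ x → a x * (β * ∑ T (σ x))) + length T * ∑ T b
        ≡⟨ cong₂ _+_ (trans (cong (p *_) (sym (factor σ β a))) (sym (∑-* T p _))) (sym (∑-const T (∑ T b))) ⟩
      ∑ T (λ c → p * (β * ∑ T (λ x → a x * σ x c))) + ∑ T (const (∑ T b))
        ≡⟨ ∑-+ T _ _ ⟨
      ∑ T (λ c → p * (β * ∑ T (λ x → a x * σ x c)) + ∑ T b) ∎)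
      where
      open ≤-Reasoning
      rearrange : ∀ n p α s → n * (p * (α * s)) ≡ p * (α * n * s)
      rearrange = solve-∀

    weaken : ∀ (a : X → ℕ) r x {m n} → a x * m ≤ a x * n → a x * r * m ≤ a x * r * n
    weaken a r x {m} {n} am≤an = subst₂ _≤_ (rearrange r (a x) m) (rearrange r (a x) n) (*-monoʳ-≤ r am≤an)
      where
      rearrange : ∀ r y m → r * (y * m) ≡ y * r * m
      rearrange = solve-∀

    _⟨_⟩ : (X → ℕ) → X → (X → ℕ)
    (a ⟨ c ⟩) x = a x * ρ x c

    select-one : ∀ k E → length E < κ → ∀ a b → Rich a → Poor b → ∑ T b < α ^ suc k * ∑ T a →
      ∃[ c ] c ∈ T × key c ∉ E ×
             α ^ k * (α * ∑ T a) + β * ∑ T (b ⟨ c ⟩) ≤ α ^ k * (β * ∑ T (a ⟨ c ⟩)) + ∑ T b ×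
             ∑ T (b ⟨ c ⟩) < α ^ k * ∑ T (a ⟨ c ⟩)
    select-one k E ∣E∣<κ a b a-rich b-poor big
      with c , c∈T , gain ← average (λ x c → free E c * ρ x c) (α ^ k) a b (a-rich E ∣E∣<κ)
             (λ {x} x∈T → ≤-trans (*-monoʳ-≤ (b x) (*-monoʳ-≤ β (∑-mono T λ {c} _ →
                ≤-trans (*-monoˡ-≤ (ρ x c) (ι≤1 (¬? (key c ∈? E)))) (≤-reflexive (+-identityʳ _))))) (b-poor x∈T))
      with key c ∈? E
    -- A forbidden c has `free E c` equal to 0, so both compatible masses vanish and `gain`
    -- contradicts `big`. Averaging thus avoids `E` by itself.
    ... | yes _ = contradiction big (≤⇒≯ (begin
      α ^ suc k * ∑ T a
        ≡⟨ rearrange α (α ^ k) (∑ T a) ⟩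
      α ^ k * (α * ∑ T a)
        ≤⟨ m≤m+n _ _ ⟩
      α ^ k * (α * ∑ T a) + β * ∑ T (λ x → b x * 0)
        ≤⟨ gain ⟩
      α ^ k * (β * ∑ T (λ x → a x * 0)) + ∑ T b
        ≡⟨ cong (λ z → α ^ k * (β * z) + ∑ T b) (factor-const a 0) ⟩
      α ^ k * (β * 0) + ∑ T b
        ≡⟨ cong (λ z → α ^ k * z + ∑ T b) (*-zeroʳ β) ⟩
      α ^ k * 0 + ∑ T b
        ≡⟨ cong (_+ ∑ T b) (*-zeroʳ (α ^ k)) ⟩
      ∑ T b ∎))
      where
      open ≤-Reasoning
      rearrange : ∀ x y z → x * y * z ≡ y * (x * z)
      rearrange = solve-∀
    -- `big` makes the gain strict; cancelling `∑ T b` and β leaves the same hypothesis for the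
    -- remaining k choices.
    ... | no c∉E = c , c∈T , c∉E , gain₁ , *-cancelˡ-< β _ _ (+-cancelˡ-< (∑ T b) _ _ (begin-strict
        ∑ T b + β * ∑ T (b ⟨ c ⟩)                   <⟨ +-monoˡ-< (β * ∑ T (b ⟨ c ⟩)) big ⟩
        α ^ suc k * ∑ T a + β * ∑ T (b ⟨ c ⟩)       ≡⟨ cong (_+ β * ∑ T (b ⟨ c ⟩)) (rearrange (α ^ k) α (∑ T a)) ⟨
        α ^ k * (α * ∑ T a) + β * ∑ T (b ⟨ c ⟩)     ≤⟨ gain₁ ⟩
        α ^ k * (β * ∑ T (a ⟨ c ⟩)) + ∑ T b         ≡⟨ +-comm _ (∑ T b) ⟩
        ∑ T b + α ^ k * (β * ∑ T (a ⟨ c ⟩))         ≡⟨ cong (∑ T b +_) (trans (rearrange (α ^ k) β _) (*-assoc β _ _)) ⟩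
        ∑ T b + β * (α ^ k * ∑ T (a ⟨ c ⟩))         ∎))
      where
      open ≤-Reasoning
      gain₁ : α ^ k * (α * ∑ T a) + β * ∑ T (b ⟨ c ⟩) ≤ α ^ k * (β * ∑ T (a ⟨ c ⟩)) + ∑ T b
      gain₁ = subst₂ (λ y z → α ^ k * (α * ∑ T a) + β * y ≤ α ^ k * (β * z) + ∑ T b)
        (∑-cong T λ {x} _ → cong (b x *_) (+-identityʳ _)) (∑-cong T λ {x} _ → cong (a x *_) (+-identityʳ _)) gain
      rearrange : ∀ x y z → x * (y * z) ≡ y * x * z
      rearrange = solve-∀

    record Selected (k : ℕ) (E : List K) (a b : X → ℕ) : Set where
      constructor selected
      field
        chosen    : List X
        size      : length chosen ≡ k
        chosen⊆T  : All (_∈ T) chosen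
        distinct  : Unique (map key chosen)
        avoids    : All (_∉ E) (map key chosen)
        mass-gain : α ^ k * ∑ T a + β ^ k * ∑ T (λ x → b x * ρ* chosen x)
                    ≤ β ^ k * ∑ T (λ x → a x * ρ* chosen x) + ∑ T b

    -- Conditional expectations for k independent uniform choices c, with the
    -- potential (mass of a) − (mass of b), moved around to avoid subtraction.
    -- Each choice scales the mass of a by at least α/β and that of b by at most 1/β.
    select : ∀ k E → length E + k ≤ κ → ∀ a b → Rich a → Poor b → ∑ T b < α ^ k * ∑ T a →
             Selected k E a b
    select zero E _ a b _ _ _ = selected [] refl [] [] []
      (≤-reflexive (cong₂ _+_ (cong (1 *_) (∑-cong T λ {x} _ → sym (*-identityʳ (a x))))
                             (trans (+-identityʳ _) (∑-cong T λ {x} _ → *-identityʳ (b x)))))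
    select (suc k) E ∣E∣+k<κ a b a-rich b-poor big
      with c , c∈T , c∉E , gain , big₁ ←
             select-one k E (≤-trans (s≤s (m≤m+n _ k)) (subst (_≤ κ) (+-suc _ k) ∣E∣+k<κ)) a b a-rich b-poor big
      with selected cs ∣cs∣≡k cs⊆T cs-unique cs∌ ih ←
             select k (key c ∷ E) (subst (_≤ κ) (+-suc _ k) ∣E∣+k<κ) (a ⟨ c ⟩) (b ⟨ c ⟩)
               (λ E ∣E∣<κ {x} x∈T → weaken a (ρ x c) x (a-rich E ∣E∣<κ x∈T))
               (λ {x} x∈T → weaken b (ρ x c) x (b-poor x∈T)) big₁
      = selected (c ∷ cs) (cong suc ∣cs∣≡k) (c∈T ∷ cs⊆T)
          (All.map (λ z∉ c≡z → z∉ (here (sym c≡z))) cs∌ ∷ cs-unique)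
          (c∉E ∷ All.map (λ z∉ → z∉ ∘ there) cs∌)
          (subst₂ (λ y z → α ^ suc k * ∑ T a + β ^ suc k * y ≤ β ^ suc k * z + ∑ T b)
          (∑-cong T λ {x} _ → *-assoc (b x) (ρ x c) _) (∑-cong T λ {x} _ → *-assoc (a x) (ρ x c) _)
          -- Adding `gain` to β times `ih` telescopes: the masses after the choice of `c` occur on
          -- both sides with equal coefficients.
          (+-cancelˡ-≤ (β * ∑ T (b ⟨ c ⟩) + α ^ k * (β * ∑ T (a ⟨ c ⟩))) _ _
            (subst₂ _≤_ (sumˡ α (α ^ k) (∑ T a) β (∑ T (b ⟨ c ⟩)) (∑ T (a ⟨ c ⟩)) (β ^ k) _)
                        (sumʳ (α ^ k) β (∑ T (b ⟨ c ⟩)) (∑ T (a ⟨ c ⟩)) (β ^ k) _ (∑ T b))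
              (+-mono-≤ gain (*-monoʳ-≤ β ih)))))
      where
      sumˡ : ∀ α p s β t u q v → p * (α * s) + β * t + β * (p * u + q * v)
                                 ≡ β * t + p * (β * u) + (α * p * s + β * q * v)
      sumˡ = solve-∀
      sumʳ : ∀ p β t u q v w → p * (β * u) + w + β * (q * v + t)
                               ≡ β * t + p * (β * u) + (β * q * v + w)
      sumʳ = solve-∀

  product-tabulate>0 : ∀ {h} (a : Fin h → ℕ) → (∀ i → 0 < a i) → 0 < product (tabulate a)
  product-tabulate>0 {zero}  a 0<a = z<s
  product-tabulate>0 {suc h} a 0<a = *-mono-< (0<a zero) (product-tabulate>0 (a ∘ suc) (0<a ∘ suc))

  module _ {A : Set} (_≟_ : DecidableEquality A) where
    open DecMembership _≟_ using (_∈?_)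

    -- The base of a pigeonhole argument: `count-∈` double counts pairs of equal entries of `xs` and
    -- `E`.
    count-≡ : ∀ {xs} → Unique xs → ∀ e → ∑ xs (λ x → ι (x ≟ e)) ≤ 1
    count-≡ []                      e = z≤n
    count-≡ {x ∷ xs} (x∉xs ∷ uniq) e with x ≟ e
    ... | no  _    = count-≡ uniq e
    ... | yes refl = s≤s (≤-reflexive (trans (∑-cong xs λ {y} y∈ → ι-no (y ≟ x) (λ y≡x → All.lookup x∉xs y∈ (sym y≡x)))
                                             (trans (∑-const xs 0) (*-zeroʳ (length xs)))))

    count-∈ : ∀ {xs} → Unique xs → ∀ E → length (filter (_∈? E) xs) ≤ length E
    count-∈ {xs} uniq E = begin
      length (filter (_∈? E) xs)              ≡⟨ length-filter≡∑ (_∈? E) xs ⟩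
      ∑ xs (λ x → ι (x ∈? E))                 ≤⟨ ∑-mono xs (λ {x} _ → hits x E) ⟩
      ∑ xs (λ x → ∑ E (λ e → ι (x ≟ e)))      ≡⟨ ∑-swap xs E (λ x e → ι (x ≟ e)) ⟩
      ∑ E (λ e → ∑ xs (λ x → ι (x ≟ e)))      ≤⟨ ∑-mono E (λ {e} _ → count-≡ uniq e) ⟩
      ∑ E (const 1)                           ≡⟨ length≡∑ E ⟨
      length E                                ∎
      where
      open ≤-Reasoning
      hits : ∀ x E → ι (x ∈? E) ≤ ∑ E (λ e → ι (x ≟ e))
      hits x []      = z≤n
      hits x (e ∷ E) with x ≟ e
      ... | yes _ = s≤s z≤n
      ... | no  _ = hits x E

  -- Canonical copies and a single round at the vertex s.

  module Canonical {h : ℕ} (H : Graph (Fin h)) {A : Set} (_≟_ : DecidableEquality A) (G : Graph A) where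

    IsCanonical : Vec A h → Set
    IsCanonical x = ∀ i j → Adj H i j → Adj G (lookup x i) (lookup x j)

    opaque
      canonical? : Decidable IsCanonical
      canonical? x = Fin.all? λ i → Fin.all? λ j → adj? H i j →-dec adj? G (lookup x i) (lookup x j)

    #canonical : (Fin h → List A) → ℕ
    #canonical V = ∑ (box V) (λ x → ι (canonical? x))

    Dense : ℕ → (Fin h → List A) → Set
    Dense D V = length (box V) ≤ D * #canonical V

    module Step (H-free : TriangleFree H) (s : Fin h) (V : Fin h → List A) (Vₛ-unique : Unique (V s))
                (D k : ℕ) (0<D : 0 < D) (0<k : 0 < k) (large : ∀ i → k * (4 * D) ≤ length (V i))
                (dense : Dense D V) where

      open DecMembership _≟_ using (_∈?_)

      m : Vec Bool h
      m = Vec.tabulate (λ i → does (adj? H s i))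

      m-true : ∀ i → lookup m i ≡ true → Adj H s i
      m-true i eq with adj? H s i | lookup∘tabulate (λ i → does (adj? H s i)) i
      ... | yes si | _   = si
      ... | no  _  | eq′ = contradiction (trans (sym eq) eq′) λ ()

      m-adj : ∀ i → Adj H s i → lookup m i ≡ true
      m-adj i si = trans (lookup∘tabulate _ i) (dec-true (adj? H s i) si)

      m-false : lookup m s ≡ false
      m-false = trans (lookup∘tabulate _ s) (dec-false (adj? H s s) (Graph.irrefl H refl))

      -- Where triangle-freeness enters: no edge of `H` links two coordinates of x, so a chosen c
      -- constrains each of them separately and the survivors fill a box.
      independent : ∀ i j → lookup m i ≡ true → lookup m j ≡ true → ¬ Adj H i j
      independent i j mi mj ij = H-free s i j (m-true i mi) ij (m-true j mj)

      T = box V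
      P = length T

      nonempty : ∀ i → 0 < length (V i)
      nonempty i = ≤-trans (*-mono-< 0<k (*-mono-< {0} {4} z<s 0<D)) (large i)

      0<P : 0 < P
      0<P = subst (0 <_) (sym (length-box V)) (product-tabulate>0 _ nonempty)

      instance
        P≢0 : NonZero P
        P≢0 = >-nonZero 0<P
        k≢0 : NonZero k
        k≢0 = >-nonZero 0<k

      opaque
        α β : ℕ
        α = 4 * D
        β = α * α

        α≡4D : α ≡ 4 * D
        α≡4D = refl

        β≡α*α : β ≡ α * α
        β≡α*α = refl

      0<α : 0 < α
      0<α = subst (0 <_) (sym α≡4D) (*-mono-< {0} {4} z<s 0<D)

      instance
        α≢0 : NonZero α
        α≢0 = >-nonZero 0<α

      ρ : Vec A h → Vec A h → ℕ
      ρ x c = ι (canonical? (merge m x c))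

      deg : Vec A h → ℕ
      deg x = ∑ T (ρ x)

      deg≤P : ∀ x → deg x ≤ P
      deg≤P x = ≤-trans (∑-mono T λ {c} _ → ι≤1 (canonical? (merge m x c))) (≤-reflexive (sym (length≡∑ T)))

      -- By `∑-merge` a pair (x , c) amounts to the merged tuple and an arbitrary second tuple made
      -- of the unread coordinates, whence the factor `P`.
      ∑-deg : ∑ T deg ≡ P * #canonical V
      ∑-deg = trans (∑-merge V m (λ y _ → ι (canonical? y)))
              (trans (∑-cong T λ _ → ∑-const T _) (∑-* T P _))

      -- Indicators of the rich x (compatible with at least a fraction 1/(2D) of all c), of the poor
      -- x (below 1/β), and of the x that are not poor. An x between the two thresholds counts as
      -- good only.
      a b good : Vec A h → ℕ
      a x    = ι (P ≤? 2 * D * deg x)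
      b x    = ι (β * deg x <? P)
      good x = ι (P ≤? β * deg x)

      double : ∀ d → 2 * D * d + 2 * D * d ≡ α * d
      double d = trans (2+2≡4 D d) (cong (_* d) (sym α≡4D))
        where
        2+2≡4 : ∀ D d → 2 * D * d + 2 * D * d ≡ 4 * D * d
        2+2≡4 = solve-∀

      2D≤β : 2 * D ≤ β
      2D≤β = ≤-trans (*-monoˡ-≤ D {2} {4} (s≤s (s≤s z≤n)))
               (subst₂ _≤_ α≡4D (sym β≡α*α) (m≤m*n α α))

      β≢0 : NonZero β
      β≢0 = >-nonZero (≤-trans (*-mono-< {0} {2} z<s 0<D) 2D≤β)

      open Selection _≟_ T 0<P (λ c → lookup c s) ρ α β k

      -- The c with s-coordinate in `E` form a box cut down only in the side s. Their proportion is
      -- therefore at most the length of `E` over that of `V s`, hence at most k/(4Dk) = 1/α.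
      hit-few : ∀ E → length E < k → α * ∑ T (λ c → ι (lookup c s ∈? E)) ≤ P
      hit-few E ∣E∣<k = *-cancelˡ-≤ k (begin
        k * (α * ∑ T (λ c → ι (lookup c s ∈? E)))         ≤⟨ *-monoʳ-≤ k (*-monoʳ-≤ α (≤-reflexive hits≡box)) ⟩
        k * (α * length (box U))                          ≡⟨ *-assoc k α _ ⟨
        k * α * length (box U)                            ≤⟨ *-monoˡ-≤ (length (box U)) (subst (λ z → k * z ≤ length (V s)) (sym α≡4D) (large s)) ⟩
        length (V s) * length (box U)                     ≡⟨ *-comm (length (V s)) _ ⟩
        length (box U) * length (V s)                     ≡⟨ cong (_* length (V s)) (length-box U) ⟩
        product (tabulate (length ∘ U)) * length (V s)    ≤⟨ product-ratio (length ∘ U) (length ∘ V) (λ i → length-filter (Q? i) (V i)) s ⟩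
        length (U s) * product (tabulate (length ∘ V))    ≡⟨ cong (length (U s) *_) (length-box V) ⟨
        length (U s) * P                                  ≤⟨ *-monoˡ-≤ P Uₛ-small ⟩
        length E * P                                      ≤⟨ *-monoˡ-≤ P (<⇒≤ ∣E∣<k) ⟩
        k * P                                             ∎)
        where
        open ≤-Reasoning
        Q : Fin h → A → Set
        Q i y = i ≡ s → y ∈ E
        Q? : ∀ i → Decidable (Q i)
        Q? i y = (i Fin.≟ s) →-dec (y ∈? E)
        U : Fin h → List A
        U i = filter (Q? i) (V i)
        Uₛ-small : length (U s) ≤ length E
        Uₛ-small = begin
          length (U s)                       ≡⟨ length-filter≡∑ (Q? s) (V s) ⟩
          ∑ (V s) (λ y → ι (Q? s y))         ≤⟨ ∑-mono (V s) (λ {y} _ → ι-mono (Q? s y) (y ∈? E) (λ q → q refl)) ⟩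
          ∑ (V s) (λ y → ι (y ∈? E))         ≡⟨ length-filter≡∑ (_∈? E) (V s) ⟨
          length (filter (_∈? E) (V s))      ≤⟨ count-∈ _≟_ Vₛ-unique E ⟩
          length E                           ∎
        hits≡box : ∑ T (λ c → ι (lookup c s ∈? E)) ≡ length (box U)
        hits≡box = sym (trans (length≡∑ (box U)) (trans (∑-box-filter V Q? (const 1)) (∑-cong T λ {c} _ →
          trans (*-identityʳ _) (ι-cong (Fin.all? λ i → Q? i (lookup c i)) (lookup c s ∈? E) (λ q → q s refl) (λ { c∈E _ refl → c∈E })))))

      -- Of the proportion 1/(2D) = 2/α of compatible c at most 1/α is lost to forbidden keys, and
      -- 1/α = α/β remains.
      a-rich : Rich a
      a-rich E ∣E∣<k {x} _ = ι-*-mono (P ≤? 2 * D * deg x) λ P≤ → subst (α * P ≤_) (trans (sym (*-assoc α α _)) (cong (_* ∑ T (λ c → free E c * ρ x c)) (sym β≡α*α))) (*-monoʳ-≤ α (+-cancelʳ-≤ P _ _ (begin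
        P + P                                  ≤⟨ +-mono-≤ P≤ P≤ ⟩
        2 * D * deg x + 2 * D * deg x          ≡⟨ double (deg x) ⟩
        α * deg x                              ≤⟨ *-monoʳ-≤ α deg≤ ⟩
        α * (freedeg + ∑ T (λ c → ι (lookup c s ∈? E)))       ≡⟨ *-distribˡ-+ α freedeg _ ⟩
        α * freedeg + α * ∑ T (λ c → ι (lookup c s ∈? E))     ≤⟨ +-monoʳ-≤ (α * freedeg) (hit-few E ∣E∣<k) ⟩
        α * freedeg + P                        ∎)))
        where
        open ≤-Reasoning
        freedeg = ∑ T (λ c → free E c * ρ x c)
        deg≤ : deg x ≤ freedeg + ∑ T (λ c → ι (lookup c s ∈? E))
        deg≤ = ≤-trans (∑-mono T λ {c} _ → ι-¬-cover (lookup c s ∈? E) (ι≤1 (canonical? (merge m x c))))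
                       (≤-reflexive (∑-+ T _ _))

      b-poor : Poor b
      b-poor {x} _ = ι-*-mono (β * deg x <? P) <⇒≤

      -- The mean of `deg` is at least P/D, and the x outside `a` contribute at most half of that.
      -- The other half comes from rich x, each contributing at most `P`.
      P≤2D∑a : P ≤ 2 * D * ∑ T a
      P≤2D∑a = *-cancelˡ-≤ P (+-cancelʳ-≤ (P * P) _ _ (begin
        P * P + P * P                          ≡⟨ cong (P * P +_) (sym (+-identityʳ _)) ⟩
        2 * (P * P)                            ≤⟨ *-monoʳ-≤ 2 (*-monoʳ-≤ P dense) ⟩
        2 * (P * (D * #canonical V))           ≡⟨ move P D (#canonical V) ⟩
        2 * D * (P * #canonical V)             ≡⟨ cong (2 * D *_) ∑-deg ⟨
        2 * D * ∑ T deg                        ≡⟨ ∑-* T (2 * D) deg ⟨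
        ∑ T (λ x → 2 * D * deg x)              ≤⟨ ∑-mono T (λ {x} _ → term x) ⟩
        ∑ T (λ x → P * (2 * D) * a x + P)      ≡⟨ ∑-+ T _ _ ⟩
        ∑ T (λ x → P * (2 * D) * a x) + ∑ T (const P)    ≡⟨ cong₂ _+_ (∑-* T (P * (2 * D)) a) (∑-const T P) ⟩
        P * (2 * D) * ∑ T a + P * P            ≡⟨ cong (_+ P * P) (*-assoc P (2 * D) _) ⟩
        P * (2 * D * ∑ T a) + P * P            ∎))
        where
        open ≤-Reasoning
        move : ∀ P D c → 2 * (P * (D * c)) ≡ 2 * D * (P * c)
        move = solve-∀
        term : ∀ x → 2 * D * deg x ≤ P * (2 * D) * a x + P
        term x = ι-either (P ≤? 2 * D * deg x)
          (λ _ → ≤-trans (*-monoʳ-≤ (2 * D) (deg≤P x)) (≤-reflexive (*-comm (2 * D) P)))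
          (λ P≰ → <⇒≤ (≰⇒> P≰))

      -- One factor α = 4D already lifts the rich mass to twice the largest possible poor mass; this
      -- is where k ≥ 1 matters.
      2P≤α^k∑a : P + P ≤ α ^ k * ∑ T a
      2P≤α^k∑a = begin
        P + P                                  ≤⟨ +-mono-≤ P≤2D∑a P≤2D∑a ⟩
        2 * D * ∑ T a + 2 * D * ∑ T a          ≡⟨ double (∑ T a) ⟩
        α * ∑ T a                              ≡⟨ cong (_* ∑ T a) (*-identityʳ α) ⟨
        α ^ 1 * ∑ T a                          ≤⟨ *-monoˡ-≤ (∑ T a) (^-monoʳ-≤ α 0<k) ⟩
        α ^ k * ∑ T a                          ∎
        where
        open ≤-Reasoning

      ∑b≤P : ∑ T b ≤ P
      ∑b≤P = ≤-trans (∑-mono T λ {x} _ → ι≤1 (β * deg x <? P)) (≤-reflexive (sym (length≡∑ T)))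

      opaque
        selection : Selected k [] a b
        selection = select k [] ≤-refl a b a-rich b-poor
                      (≤-<-trans ∑b≤P (<-≤-trans (m<n+m P 0<P) 2P≤α^k∑a))

      open Selected selection public renaming (chosen to cs; chosen⊆T to cs⊆T; distinct to W-unique)

      W : List A
      W = map (λ c → lookup c s) cs

      ∣W∣≡k : length W ≡ k
      ∣W∣≡k = trans (length-map _ cs) size

      W⊆V : ∀ {w} → w ∈ W → w ∈ V s
      W⊆V w∈W with c , c∈cs , refl ← ∈-map⁻ (λ c → lookup c s) w∈W = ∈-box⁻ V (All.lookup cs⊆T c∈cs) s

      u : Vec A h → ℕ
      u = ρ* cs

      -- Serves twice. Without the b-term it says that at least P/β^k of the x survive, which keeps
      -- the sides large; without `P` it says that poor survivors do not outnumber rich ones, which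
      -- keeps the density free of k.
      gain : P + β ^ k * ∑ T (λ x → b x * u x) ≤ β ^ k * ∑ T (λ x → a x * u x)
      gain = +-cancelʳ-≤ P _ _ (begin
        P + β ^ k * ∑ T (λ x → b x * u x) + P           ≡⟨ rearrange P _ ⟩
        P + P + β ^ k * ∑ T (λ x → b x * u x)           ≤⟨ +-monoˡ-≤ _ 2P≤α^k∑a ⟩
        α ^ k * ∑ T a + β ^ k * ∑ T (λ x → b x * u x)   ≤⟨ mass-gain ⟩
        β ^ k * ∑ T (λ x → a x * u x) + ∑ T b           ≤⟨ +-monoʳ-≤ _ ∑b≤P ⟩
        β ^ k * ∑ T (λ x → a x * u x) + P               ∎)
        where
        open ≤-Reasoning
        rearrange : ∀ p q → p + q + p ≡ p + p + q
        rearrange = solve-∀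

      u≤1 : ∀ x → u x ≤ 1
      u≤1 x = go cs
        where
        go : ∀ cs → ρ* cs x ≤ 1
        go []       = ≤-refl
        go (c ∷ cs) = *-mono-≤ (ι≤1 (canonical? (merge m x c))) (go cs)

      u>0 : ∀ x → 0 < u x → ∀ {c} → c ∈ cs → IsCanonical (merge m x c)
      u>0 x = go cs
        where
        go : ∀ cs → 0 < ρ* cs x → ∀ {c} → c ∈ cs → IsCanonical (merge m x c)
        go (c ∷ cs) 0<u (here refl) = proj₁ (ι-*-elim (canonical? (merge m x c)) 0<u)
        go (c ∷ cs) 0<u (there c∈)  = go cs (proj₂ (ι-*-elim (canonical? (merge m x c)) 0<u)) c∈

      u≡1 : ∀ x → (∀ {c} → c ∈ cs → IsCanonical (merge m x c)) → u x ≡ 1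
      u≡1 x = go cs
        where
        go : ∀ cs → (∀ {c} → c ∈ cs → IsCanonical (merge m x c)) → ρ* cs x ≡ 1
        go []       can = refl
        go (c ∷ cs) can = cong₂ _*_ (ι-yes (canonical? (merge m x c)) (can (here refl))) (go cs (can ∘ there))

      -- The conditions that the chosen tuples impose on one coordinate in N(s), through edges of
      -- `H` leaving N(s). Off N(s) it is vacuous, so those sides do not shrink.
      Q : Fin h → A → Set
      Q i y = lookup m i ≡ true → All (λ c → ∀ j → lookup m j ≡ false → Adj H i j → Adj G (lookup c j) y) cs

      opaque
        Q? : ∀ i → Decidable (Q i)
        Q? i y = (lookup m i Bool.≟ true) →-dec
          All.all? (λ c → Fin.all? λ j → (lookup m j Bool.≟ false) →-dec (adj? H i j →-dec adj? G (lookup c j) y)) cs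

      V′ : Fin h → List A
      V′ i = filter (Q? i) (V i)

      inside? : ∀ x → Dec (∀ i → Q i (lookup x i))
      inside? x = Fin.all? λ i → Q? i (lookup x i)

      canonical⇒Q : ∀ x → (∀ {c} → c ∈ cs → IsCanonical (merge m x c)) → ∀ i → Q i (lookup x i)
      canonical⇒Q x can i mi = All.tabulate λ {c} c∈ j mj ij →
        subst₂ (Adj G) (lookup-merge-false m x c j mj) (lookup-merge-true m x c i mi)
               (can c∈ j i (Graph.sym H ij))

      u≤inside : ∀ x → u x ≤ ι (inside? x)
      u≤inside x with 0 <? u x
      ... | yes 0<u = ≤-trans (u≤1 x) (≤-reflexive (sym (ι-yes (inside? x) (canonical⇒Q x (u>0 x 0<u)))))
      ... | no  0≮u = ≤-trans (≮⇒≥ 0≮u) z≤n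

      -- There are no edges inside N(s), and those leaving N(s) are given by `Q`. The edges avoiding
      -- N(s) concern `c` alone; the survivor `x₀` certifies that they are present. With `u≤inside`
      -- this identifies the survivors with the box of `V′`.
      Q⇒canonical : ∀ x₀ → 0 < u x₀ → ∀ x → (∀ i → Q i (lookup x i)) → ∀ {c} → c ∈ cs → IsCanonical (merge m x c)
      Q⇒canonical x₀ 0<u x q {c} c∈ i j ij with lookup m i in mi | lookup m j in mj
      ... | true  | true  = contradiction ij (independent i j mi mj)
      ... | true  | false = subst₂ (Adj G) (sym (lookup-merge-true m x c i mi)) (sym (lookup-merge-false m x c j mj))
                              (Graph.sym G (All.lookup (q i mi) c∈ j mj ij))
      ... | false | true  = subst₂ (Adj G) (sym (lookup-merge-false m x c i mi)) (sym (lookup-merge-true m x c j mj))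
                              (All.lookup (q j mj) c∈ i mi (Graph.sym H ij))
      ... | false | false = subst₂ (Adj G) (same i mi) (same j mj) (u>0 x₀ 0<u c∈ i j ij)
        where
        same : ∀ i → lookup m i ≡ false → lookup (merge m x₀ c) i ≡ lookup (merge m x c) i
        same i mi = trans (lookup-merge-false m x₀ c i mi) (sym (lookup-merge-false m x c i mi))

      ∑au≤∑u : ∑ T (λ x → a x * u x) ≤ ∑ T u
      ∑au≤∑u = ∑-mono T λ {x} _ → ≤-trans (*-monoˡ-≤ (u x) (ι≤1 (P ≤? 2 * D * deg x))) (≤-reflexive (*-identityˡ (u x)))

      P≤β^k∑u : P ≤ β ^ k * ∑ T u
      P≤β^k∑u = ≤-trans (m≤m+n P _) (≤-trans gain (*-monoʳ-≤ (β ^ k) ∑au≤∑u))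

      0<∑u : 0 < ∑ T u
      0<∑u = n≢0⇒n>0 λ ∑u≡0 → <⇒≱ 0<P (≤-trans P≤β^k∑u (≤-reflexive (trans (cong (β ^ k *_) ∑u≡0) (*-zeroʳ (β ^ k)))))

      u≡inside : ∀ x → u x ≡ ι (inside? x)
      u≡inside x with x₀ , _ , 0<u ← ∑>0⇒∃>0 T u 0<∑u = ≤-antisym (u≤inside x)
        (ι-≤ (inside? x) λ q → ≤-reflexive (sym (u≡1 x (Q⇒canonical x₀ 0<u x q))))

      ∣box-V′∣ : length (box V′) ≡ ∑ T u
      ∣box-V′∣ = trans (length≡∑ (box V′)) (trans (∑-box-filter V Q? (const 1))
                   (∑-cong T λ {x} _ → trans (*-identityʳ _) (sym (u≡inside x))))

      large′ : ∀ i → length (V i) ≤ β ^ k * length (V′ i)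
      large′ i = *-cancelʳ-≤ _ _ (length (box V′)) {{>-nonZero (subst (0 <_) (sym ∣box-V′∣) 0<∑u)}} (begin
        length (V i) * length (box V′)                    ≡⟨ *-comm (length (V i)) _ ⟩
        length (box V′) * length (V i)                    ≡⟨ cong (_* length (V i)) (length-box V′) ⟩
        product (tabulate (length ∘ V′)) * length (V i)   ≤⟨ product-ratio (length ∘ V′) (length ∘ V) (λ i → length-filter (Q? i) (V i)) i ⟩
        length (V′ i) * product (tabulate (length ∘ V))   ≡⟨ cong (length (V′ i) *_) (length-box V) ⟨
        length (V′ i) * P                                 ≤⟨ *-monoʳ-≤ (length (V′ i)) P≤β^k∑u ⟩
        length (V′ i) * (β ^ k * ∑ T u)                   ≡⟨ cong (λ z → length (V′ i) * (β ^ k * z)) (sym ∣box-V′∣) ⟩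
        length (V′ i) * (β ^ k * length (box V′))         ≡⟨ rearrange (length (V′ i)) (β ^ k) _ ⟩
        β ^ k * length (V′ i) * length (box V′)           ∎)
        where
        open ≤-Reasoning
        rearrange : ∀ x y z → x * (y * z) ≡ y * x * z
        rearrange = solve-∀

      -- Since s lies off N(s), the s-coordinates of the chosen tuples are among the vertices that
      -- `Q` tests against.
      W-complete : ∀ {i w v} → Adj H s i → w ∈ W → v ∈ V′ i → Adj G w v
      W-complete {i} {w} {v} si w∈W v∈V′ with c , c∈cs , refl ← ∈-map⁻ (λ c → lookup c s) w∈W =
        All.lookup (proj₂ (∈-filter⁻ (Q? i) {v} {V i} v∈V′) (m-adj i si)) c∈cs s m-false (Graph.sym H si)

      ∑bu≤∑au : ∑ T (λ x → b x * u x) ≤ ∑ T (λ x → a x * u x)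
      ∑bu≤∑au = *-cancelˡ-≤ (β ^ k) {{m^n≢0 β k {{β≢0}}}} (≤-trans (m≤n+m _ P) gain)

      -- A survivor that is not good is poor, and the poor survivors are at most as many as the rich
      -- ones, which are all good.
      ∑u≤2∑good : ∑ T u ≤ 2 * ∑ T (λ x → good x * u x)
      ∑u≤2∑good = begin
        ∑ T u                                                       ≤⟨ ∑-mono T (λ {x} _ → ι-cover (u x) (P ≤? β * deg x) (β * deg x <? P) ≰⇒>) ⟩
        ∑ T (λ x → good x * u x + b x * u x)                        ≡⟨ ∑-+ T _ _ ⟩
        ∑ T (λ x → good x * u x) + ∑ T (λ x → b x * u x)            ≤⟨ +-monoʳ-≤ _ ∑bu≤∑au ⟩
        ∑ T (λ x → good x * u x) + ∑ T (λ x → a x * u x)            ≤⟨ +-monoʳ-≤ _ (∑-mono T λ {x} _ → *-monoˡ-≤ (u x) (a≤good x)) ⟩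
        ∑ T (λ x → good x * u x) + ∑ T (λ x → good x * u x)         ≡⟨ cong (∑ T (λ x → good x * u x) +_) (sym (+-identityʳ _)) ⟩
        2 * ∑ T (λ x → good x * u x)                                ∎
        where
        open ≤-Reasoning
        a≤good : ∀ x → a x ≤ good x
        a≤good x = ι-mono (P ≤? 2 * D * deg x) (P ≤? β * deg x) λ P≤ →
          ≤-trans P≤ (*-monoˡ-≤ (deg x) 2D≤β)

      -- The sides off N(s) are unchanged, so completing a survivor by any compatible c yields a
      -- copy inside the new sides. No copy counted by `deg` is lost.
      ∑u*deg≤ : ∑ T (λ x → u x * deg x) ≤ P * #canonical V′
      ∑u*deg≤ = begin
        ∑ T (λ x → u x * deg x)                                     ≡⟨ ∑-cong T (λ {x} _ → ∑-* T (u x) (ρ x)) ⟨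
        ∑ T (λ x → ∑ T (λ c → u x * ρ x c))                         ≤⟨ ∑-mono T (λ {x} _ → ∑-mono T λ {c} _ → term x c) ⟩
        ∑ T (λ x → ∑ T (λ c → K (merge m x c)))                     ≡⟨ ∑-merge V m (λ y _ → K y) ⟩
        ∑ T (λ y → ∑ T (λ _ → K y))                                 ≡⟨ trans (∑-cong T λ _ → ∑-const T _) (∑-* T P K) ⟩
        P * ∑ T K                                                   ≡⟨ cong (P *_) (∑-box-filter V Q? (λ x → ι (canonical? x))) ⟨
        P * #canonical V′                                           ∎
        where
        open ≤-Reasoning
        K : Vec A h → ℕ
        K y = ι (inside? y) * ι (canonical? y)
        Q-merge : ∀ x c → (∀ i → Q i (lookup x i)) → ∀ i → Q i (lookup (merge m x c) i)
        Q-merge x c q i mi = subst (λ y → All (λ c → ∀ j → lookup m j ≡ false → Adj H i j → Adj G (lookup c j) y) cs)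
                               (sym (lookup-merge-true m x c i mi)) (q i mi)
        term : ∀ x c → u x * ρ x c ≤ K (merge m x c)
        term x c = *-monoˡ-≤ (ρ x c) (≤-trans (u≤inside x) (ι-mono (inside? x) (inside? (merge m x c)) (Q-merge x c)))

      -- At least half of the survivors have `deg` at least P/β, which gives the density 1/(2β) =
      -- 2^-(2g+5) when D = 2^g.
      dense′ : Dense (2 * β) V′
      dense′ = *-cancelˡ-≤ P (begin
        P * length (box V′)                          ≡⟨ cong (P *_) ∣box-V′∣ ⟩
        P * ∑ T u                                    ≤⟨ *-monoʳ-≤ P ∑u≤2∑good ⟩
        P * (2 * ∑ T (λ x → good x * u x))           ≡⟨ move P 2 _ ⟩
        2 * (P * ∑ T (λ x → good x * u x))           ≡⟨ cong (2 *_) (∑-* T P _) ⟨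
        2 * ∑ T (λ x → P * (good x * u x))           ≤⟨ *-monoʳ-≤ 2 (∑-mono T λ {x} _ → term x) ⟩
        2 * ∑ T (λ x → β * (u x * deg x))            ≡⟨ cong (2 *_) (∑-* T β _) ⟩
        2 * (β * ∑ T (λ x → u x * deg x))            ≤⟨ *-monoʳ-≤ 2 (*-monoʳ-≤ β ∑u*deg≤) ⟩
        2 * (β * (P * #canonical V′))                ≡⟨ move′ 2 β P _ ⟩
        P * (2 * β * #canonical V′)                  ∎)
        where
        open ≤-Reasoning
        move : ∀ x y z → x * (y * z) ≡ y * (x * z)
        move = solve-∀
        move′ : ∀ t b p c → t * (b * (p * c)) ≡ p * (t * b * c)
        move′ = solve-∀
        term : ∀ x → P * (good x * u x) ≤ β * (u x * deg x)
        term x = begin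
          P * (good x * u x)              ≡⟨ rearrange P (good x) (u x) ⟩
          good x * P * u x                ≤⟨ *-monoˡ-≤ (u x) (ι-*-mono (P ≤? β * deg x) (λ P≤ → P≤)) ⟩
          good x * (β * deg x) * u x      ≤⟨ *-monoˡ-≤ (u x) (*-monoˡ-≤ (β * deg x) (ι≤1 (P ≤? β * deg x))) ⟩
          1 * (β * deg x) * u x           ≡⟨ rearrange′ β (deg x) (u x) ⟩
          β * (u x * deg x)               ∎
          where
          rearrange : ∀ p g u → p * (g * u) ≡ g * p * u
          rearrange = solve-∀
          rearrange′ : ∀ b d u → 1 * (b * d) * u ≡ b * (u * d)
          rearrange′ = solve-∀

  -- Iteration of the rounds and the choice of k.

  ⌊log₂⌋ : ∀ n → 0 < n → ∃[ L ] 2 ^ L ≤ n × n < 2 ^ suc L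
  ⌊log₂⌋ (suc zero)      _ = 0 , ≤-refl , ≤-refl
  ⌊log₂⌋ (suc n@(suc _)) _ with L , 2^L≤n , n<2^1+L ← ⌊log₂⌋ n z<s with suc n <? 2 ^ suc L
  ... | yes below = L , m≤n⇒m≤1+n 2^L≤n , below
  ... | no  above = suc L , ≮⇒≥ above , ≤-<-trans n<2^1+L (m<m+n (2 ^ suc L) (≤-trans (m^n>0 2 (suc L)) (m≤m+n _ 0)))

  -- A round spends (2g + 4)k of the exponent L in 2 ^ L ≤ ∣V i∣ and
  -- worsens the density from 2^-g to 2^-(2g + 5).
  budget : ℕ → ℕ → ℕ
  budget zero    g = 0
  budget (suc m) g = 2 * g + 4 + budget m (2 * g + 5)

  -- For g ≥ 1 one has 2g + 4 ≤ 6g and 2g + 5 ≤ 7g, so the budget is linear in g with this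
  -- coefficient.
  budget-const : ℕ → ℕ
  budget-const zero    = 0
  budget-const (suc m) = 6 + 7 * budget-const m

  budget≤ : ∀ m g → 0 < g → budget m g ≤ budget-const m * g
  budget≤ zero    g 0<g = z≤n
  budget≤ (suc m) g 0<g = begin
    2 * g + 4 + budget m (2 * g + 5)                     ≤⟨ +-monoʳ-≤ (2 * g + 4) (budget≤ m (2 * g + 5) (m<n⇒m<o+n (2 * g) z<s)) ⟩
    2 * g + 4 + budget-const m * (2 * g + 5)             ≤⟨ +-mono-≤ (+-monoʳ-≤ (2 * g) (*-monoʳ-≤ 4 0<g))
                                                              (*-monoʳ-≤ (budget-const m) (+-monoʳ-≤ (2 * g) (*-monoʳ-≤ 5 0<g))) ⟩
    2 * g + 4 * g + budget-const m * (2 * g + 5 * g)     ≡⟨ collect g (budget-const m) ⟩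
    (6 + 7 * budget-const m) * g                         ∎
    where
    open ≤-Reasoning
    m<n⇒m<o+n : ∀ o {m n} → m < n → m < o + n
    m<n⇒m<o+n o m<n = ≤-trans m<n (m≤n+m _ o)
    collect : ∀ g c → 2 * g + 4 * g + c * (2 * g + 5 * g) ≡ (6 + 7 * c) * g
    collect = solve-∀

  -- The successor keeps it positive for h = 0, since it serves as a divisor.
  exponent-const : ℕ → ℕ
  exponent-const h = suc (budget-const h)

  module _ {h : ℕ} (H : Graph (Fin h)) {A : Set} (_≟_ : DecidableEquality A) (G : Graph A) where

    open Canonical H _≟_ G

    -- Sizes and joins are demanded only on `S`, the vertices still to be treated when the current
    -- sides are `V`.
    record Blowup (V : Fin h → List A) (S : List (Fin h)) (k : ℕ) : Set where
      field
        part     : Fin h → List A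
        part⊆    : ∀ i {w} → w ∈ part i → w ∈ V i
        size     : ∀ {i} → i ∈ S → length (part i) ≡ k
        unique   : ∀ i → Unique (part i)
        complete : ∀ {i j} → i ∈ S → j ∈ S → Adj H i j → ∀ {w v} → w ∈ part i → v ∈ part j → Adj G w v

    -- All later parts lie inside `V′`, so joining `W` to `V′` settles every edge at `s` before
    -- those parts are chosen.
    extend : ∀ {V V′ : Fin h → List A} {S s k} {W : List A} →
             (∀ {i v} → v ∈ V′ i → v ∈ V i) → (∀ {w} → w ∈ W → w ∈ V s) → length W ≡ k → Unique W →
             (∀ {i w v} → Adj H s i → w ∈ W → v ∈ V′ i → Adj G w v) →
             Blowup V′ S k → Blowup V (s ∷ S) k
    extend {V} {V′} {S} {s} {k} {W} V′⊆V W⊆V ∣W∣≡k W-unique W-complete B = record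
      { part = part′ ; part⊆ = part′⊆ ; size = size′ ; unique = unique′ ; complete = complete′ }
      where
      open Blowup B
      part′ : Fin h → List A
      part′ i with i Fin.≟ s
      ... | yes _ = W
      ... | no  _ = part i
      tail : ∀ {i} → i ≢ s → i ∈ s ∷ S → i ∈ S
      tail i≢s (here i≡s)  = contradiction i≡s i≢s
      tail i≢s (there i∈S) = i∈S
      part′⊆ : ∀ i {w} → w ∈ part′ i → w ∈ V i
      part′⊆ i w∈ with i Fin.≟ s
      ... | yes refl = W⊆V w∈
      ... | no  _    = V′⊆V (part⊆ i w∈)
      size′ : ∀ {i} → i ∈ s ∷ S → length (part′ i) ≡ k
      size′ {i} i∈ with i Fin.≟ s
      ... | yes _   = ∣W∣≡k
      ... | no  i≢s = size (tail i≢s i∈)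
      unique′ : ∀ i → Unique (part′ i)
      unique′ i with i Fin.≟ s
      ... | yes _ = W-unique
      ... | no  _ = unique i
      complete′ : ∀ {i j} → i ∈ s ∷ S → j ∈ s ∷ S → Adj H i j → ∀ {w v} → w ∈ part′ i → v ∈ part′ j → Adj G w v
      complete′ {i} {j} i∈ j∈ ij w∈ v∈ with i Fin.≟ s | j Fin.≟ s
      ... | yes refl | yes refl = contradiction ij (Graph.irrefl H refl)
      ... | yes refl | no  _    = W-complete ij w∈ (part⊆ j v∈)
      ... | no  _    | yes refl = Graph.sym G (W-complete (Graph.sym H ij) v∈ (part⊆ i w∈))
      ... | no  i≢s  | no  j≢s  = complete (tail i≢s i∈) (tail j≢s j∈) ij w∈ v∈

    blowup-rounds : TriangleFree H → ∀ S g k L V → 0 < k → (∀ i → Unique (V i)) → (∀ i → 2 ^ L ≤ length (V i)) →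
                    budget (length S) g * k ≤ L → Dense (2 ^ g) V → Blowup V S k
    blowup-rounds _ [] g k L V _ _ _ _ _ = record
      { part = const [] ; part⊆ = λ _ () ; size = λ () ; unique = λ _ → [] ; complete = λ () }
    blowup-rounds H-free (s ∷ S) g k L V 0<k uniq large enough dense =
      extend (λ {i} {v} v∈ → proj₁ (∈-filter⁻ (Q? i) {v} {V i} v∈)) W⊆V ∣W∣≡k W-unique W-complete
        (blowup-rounds H-free S (2 * g + 5) k (L ∸ e) V′ 0<k (λ i → Unique.filter⁺ (Q? i) (uniq i)) large″
          (subst (_≤ L ∸ e) (m+n∸m≡n e _) (∸-monoˡ-≤ e enough′))
          (subst (λ D → Dense D V′) 2β≡ dense′))
      where
      open ≤-Reasoning
      e = (2 * g + 4) * k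
      enough′ : e + budget (length S) (2 * g + 5) * k ≤ L
      enough′ = ≤-trans (≤-reflexive (sym (*-distribʳ-+ k (2 * g + 4) _))) enough
      -- The size needed for distinct s-coordinates is covered by the expense of the round itself: k
      -- and 2 + g are both at most k(2 + g), and `e` is twice that.
      k*4*2^g≤2^L : k * (4 * 2 ^ g) ≤ 2 ^ L
      k*4*2^g≤2^L = begin
        k * (4 * 2 ^ g)              ≤⟨ *-monoˡ-≤ (4 * 2 ^ g) (<⇒≤ (n<2^n k)) ⟩
        2 ^ k * (4 * 2 ^ g)          ≡⟨ cong (2 ^ k *_) (^-distribˡ-+-* 2 2 g) ⟨
        2 ^ k * 2 ^ (2 + g)          ≡⟨ ^-distribˡ-+-* 2 k (2 + g) ⟨
        2 ^ (k + (2 + g))            ≤⟨ ^-monoʳ-≤ 2 k+2+g≤L ⟩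
        2 ^ L                        ∎
        where
        k+2+g≤L : k + (2 + g) ≤ L
        k+2+g≤L = begin
          k + (2 + g)                    ≡⟨ cong₂ _+_ (sym (*-identityʳ k)) (sym (*-identityˡ (2 + g))) ⟩
          k * 1 + 1 * (2 + g)            ≤⟨ +-mono-≤ (*-monoʳ-≤ k {1} {2 + g} (s≤s z≤n)) (*-monoˡ-≤ (2 + g) 0<k) ⟩
          k * (2 + g) + k * (2 + g)      ≡⟨ double k g ⟩
          e                              ≤⟨ m≤m+n e _ ⟩
          e + budget (length S) (2 * g + 5) * k    ≤⟨ enough′ ⟩
          L                              ∎
          where
          double : ∀ k g → k * (2 + g) + k * (2 + g) ≡ (2 * g + 4) * k
          double = solve-∀
      open Step H-free s V (uniq s) (2 ^ g) k (m^n>0 2 g) 0<k (λ i → ≤-trans k*4*2^g≤2^L (large i)) dense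
        using (α; β; α≡4D; β≡α*α; Q?; W; V′; ∣W∣≡k; W-unique; W⊆V; W-complete; large′; dense′)
      β≡ : β ≡ 2 ^ (2 * g + 4)
      β≡ = begin-equality
        β                          ≡⟨ β≡α*α ⟩
        α * α                      ≡⟨ cong₂ _*_ α≡4D α≡4D ⟩
        4 * 2 ^ g * (4 * 2 ^ g)    ≡⟨ cong₂ _*_ (^-distribˡ-+-* 2 2 g) (^-distribˡ-+-* 2 2 g) ⟨
        2 ^ (2 + g) * 2 ^ (2 + g)  ≡⟨ ^-distribˡ-+-* 2 (2 + g) (2 + g) ⟨
        2 ^ (2 + g + (2 + g))      ≡⟨ cong (2 ^_) (double g) ⟩
        2 ^ (2 * g + 4)            ∎
        where
        double : ∀ g → 2 + g + (2 + g) ≡ 2 * g + 4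
        double = solve-∀
      2β≡ : 2 * β ≡ 2 ^ (2 * g + 5)
      2β≡ = trans (cong (2 *_) β≡) (cong (2 ^_) (sym (+-suc (2 * g) 4)))
      large″ : ∀ i → 2 ^ (L ∸ e) ≤ length (V′ i)
      large″ i = *-cancelˡ-≤ (2 ^ e) {{m^n≢0 2 e}} (begin
        2 ^ e * 2 ^ (L ∸ e)                  ≡⟨ ^-distribˡ-+-* 2 e (L ∸ e) ⟨
        2 ^ (e + (L ∸ e))                    ≡⟨ cong (2 ^_) (m+[n∸m]≡n (≤-trans (m≤m+n e _) enough′)) ⟩
        2 ^ L                                ≤⟨ large i ⟩
        length (V i)                         ≤⟨ large′ i ⟩
        β ^ k * length (V′ i)                ≡⟨ cong (λ z → z ^ k * length (V′ i)) β≡ ⟩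
        (2 ^ (2 * g + 4)) ^ k * length (V′ i)    ≡⟨ cong (_* length (V′ i)) (^-*-assoc 2 (2 * g + 4) k) ⟩
        2 ^ e * length (V′ i)                ∎)

    -- The fallback when n is too small to pay for the rounds: then k = 1 already meets the
    -- logarithmic bound.
    single-copy : ∀ V → 0 < #canonical V → Blowup V (allFin h) 1
    single-copy V 0<# with x , x∈ , 0<ι ← ∑>0⇒∃>0 (box V) (λ x → ι (canonical? x)) 0<# = record
      { part     = λ i → lookup x i ∷ []
      ; part⊆    = λ { i (here refl) → ∈-box⁻ V x∈ i }
      ; size     = λ _ → refl
      ; unique   = λ _ → [] ∷ []
      ; complete = λ { {i} {j} _ _ ij (here refl) (here refl) → canonical i j ij }
      }
      where
      canonical : IsCanonical x
      canonical = proj₁ (ι-*-elim (canonical? x) (subst (0 <_) (sym (*-identityʳ _)) 0<ι))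

    -- With C the value of `exponent-const h`, k is the integer part of L/(Cg), or 1 if that is 0.
    -- The factor 2 in the exponent absorbs both this rounding and n < 2^(L+1).
    blowup : TriangleFree H → ∀ V g n → 0 < g → 0 < n → (∀ i → Unique (V i)) → (∀ i → n ≤ length (V i)) → Dense (2 ^ g) V →
             ∃[ k ] 0 < k × n < 2 ^ (2 * k * (exponent-const h * g)) × Blowup V (allFin h) k
    blowup H-free V g@(suc _) n 0<g 0<n uniq large dense
      with L , 2^L≤n , n<2^1+L ← ⌊log₂⌋ n 0<n
      with L / (exponent-const h * g) | m≡m%n+[m/n]*n L (exponent-const h * g)
         | m%n<n L (exponent-const h * g) | m/n*n≤m L (exponent-const h * g)
    ... | zero | L≡ | %< | _ = 1 , z<s , <-≤-trans n<2^1+L (^-monoʳ-≤ 2 (begin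
        suc L                             ≡⟨ cong suc (trans L≡ (+-identityʳ _)) ⟩
        suc (L % (exponent-const h * g))    ≤⟨ %< ⟩
        exponent-const h * g                ≤⟨ m≤m+n _ _ ⟩
        2 * 1 * (exponent-const h * g)      ∎)) , single-copy V 0<#
      where
      open ≤-Reasoning
      0<# : 0 < #canonical V
      0<# = n≢0⇒n>0 λ #≡0 → <⇒≱ (subst (0 <_) (sym (length-box V)) (product-tabulate>0 _ (λ i → ≤-trans 0<n (large i))))
              (≤-trans dense (≤-reflexive (trans (cong (2 ^ g *_) #≡0) (*-zeroʳ (2 ^ g)))))
    ... | k@(suc _) | L≡ | %< | k*≤L = k , z<s , <-≤-trans n<2^1+L (^-monoʳ-≤ 2 (begin
        suc L                                                              ≡⟨ cong suc L≡ ⟩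
        suc (L % (exponent-const h * g)) + k * (exponent-const h * g)          ≤⟨ +-monoˡ-≤ _ %< ⟩
        exponent-const h * g + k * (exponent-const h * g)                      ≤⟨ +-monoˡ-≤ (k * (exponent-const h * g)) (m≤n*m (exponent-const h * g) k) ⟩
        k * (exponent-const h * g) + k * (exponent-const h * g)                ≡⟨ double k (exponent-const h * g) ⟩
        2 * k * (exponent-const h * g)                                       ∎))
      , blowup-rounds H-free (allFin h) g k L V z<s uniq (λ i → ≤-trans 2^L≤n (large i)) (begin
        budget (length (allFin h)) g * k      ≡⟨ cong (λ z → budget z g * k) (length-tabulate {n = h} (λ i → i)) ⟩
        budget h g * k                        ≤⟨ *-monoˡ-≤ k (≤-trans (budget≤ h g 0<g) (m≤n+m _ g)) ⟩
        exponent-const h * g * k                ≡⟨ *-comm (exponent-const h * g) k ⟩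
        k * (exponent-const h * g)              ≤⟨ k*≤L ⟩
        L                                     ∎) dense
      where
      open ≤-Reasoning
      double : ∀ k c → k * c + k * c ≡ 2 * k * c
      double = solve-∀

  -- Translation between subsets and duplicate-free lists.

  module _ {N : ℕ} where
    open DecMembership (Fin._≟_ {N}) using (_∈?_)

    elements : Subset N → List (Fin N)
    elements p = filter (Subset._∈? p) (allFin N)

    fromElements : List (Fin N) → Subset N
    fromElements xs = Vec.tabulate (λ i → does (i ∈? xs))

    ∈-elements⁻ : ∀ {p i} → i ∈ elements p → i Subset.∈ p
    ∈-elements⁻ {p} i∈ = proj₂ (∈-filter⁻ (Subset._∈? p) {xs = allFin N} i∈)

    elements-unique : ∀ p → Unique (elements p)
    elements-unique p = Unique.filter⁺ (Subset._∈? p) (Unique.allFin⁺ N)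

    ∈-fromElements⁺ : ∀ {xs i} → i ∈ xs → i Subset.∈ fromElements xs
    ∈-fromElements⁺ {xs} {i} i∈xs = lookup⇒[]= i _ (trans (lookup∘tabulate _ i) (dec-true (i ∈? xs) i∈xs))

    ∈-fromElements⁻ : ∀ {xs i} → i Subset.∈ fromElements xs → i ∈ xs
    ∈-fromElements⁻ {xs} {i} i∈ with i ∈? xs | trans (sym (lookup∘tabulate (λ i → does (i ∈? xs)) i)) ([]=⇒lookup i∈)
    ... | yes i∈xs | _ = i∈xs

  length-elements : ∀ {N} (p : Subset N) → length (elements p) ≡ ∣ p ∣
  length-elements p = trans (length-filter≡∑ (Subset._∈? p) (allFin _)) (count p)
    where
    count : ∀ {N} (p : Subset N) → ∑ (allFin N) (λ i → ι (i Subset.∈? p)) ≡ ∣ p ∣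
    count []      = refl
    count {suc N} (s ∷ p) = trans (cong (ι (zero Subset.∈? (s ∷ p)) +_) (begin
        ∑ (tabulate suc) (λ i → ι (i Subset.∈? (s ∷ p)))       ≡⟨ cong (λ xs → ∑ xs (λ i → ι (i Subset.∈? (s ∷ p)))) (map-tabulate {n = N} id Fin.suc) ⟨
        ∑ (map suc (allFin N)) (λ i → ι (i Subset.∈? (s ∷ p))) ≡⟨ ∑-map suc (allFin N) _ ⟩
        ∑ (allFin N) (λ i → ι (suc i Subset.∈? (s ∷ p)))       ≡⟨ ∑-cong (allFin N) (λ {i} _ → ι-cong (suc i Subset.∈? (s ∷ p)) (i Subset.∈? p) (λ { (there i∈p) → i∈p }) there) ⟩
        ∑ (allFin N) (λ i → ι (i Subset.∈? p))                 ≡⟨ count p ⟩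
        ∣ p ∣                                                  ∎)) (head s)
      where
      open ≡-Reasoning
      head : ∀ s → ι (zero Subset.∈? (s ∷ p)) + ∣ p ∣ ≡ ∣ s ∷ p ∣
      head inside  = refl
      head outside = refl

  -- Pigeonhole in both directions: `xs` and `listed` are duplicate-free and have the same members.
  ∣fromElements∣ : ∀ {N} {xs : List (Fin N)} → Unique xs → ∣ fromElements xs ∣ ≡ length xs
  ∣fromElements∣ {N} {xs} xs-unique = begin
    ∣ fromElements xs ∣                                      ≡⟨ length-elements (fromElements xs) ⟨
    length (elements (fromElements xs))                      ≡⟨ length-filter≡∑ _ (allFin N) ⟩
    ∑ (allFin N) (λ i → ι (i Subset.∈? fromElements xs))     ≡⟨ ∑-cong (allFin N) (λ {i} _ → ι-cong (i Subset.∈? fromElements xs) (i ∈? xs) ∈-fromElements⁻ ∈-fromElements⁺) ⟩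
    ∑ (allFin N) (λ i → ι (i ∈? xs))                         ≡⟨ length-filter≡∑ (_∈? xs) (allFin N) ⟨
    length listed                                            ≡⟨ ≤-antisym (count-∈ Fin._≟_ (Unique.allFin⁺ N) xs) xs≤ ⟩
    length xs                                                ∎
    where
    open ≡-Reasoning
    open DecMembership (Fin._≟_ {N}) using (_∈?_)
    listed = filter (_∈? xs) (allFin N)
    xs≤ : length xs ≤ length listed
    xs≤ = subst (_≤ length listed)
      (cong length (filter-all (_∈? listed) (All.tabulate λ {i} i∈xs → ∈-filter⁺ (_∈? xs) (∈-allFin i) i∈xs)))
      (count-∈ Fin._≟_ xs-unique listed)

  lookup-injective : ∀ {A : Set} {xs : List A} → Unique xs → ∀ {i j} → List.lookup xs i ≡ List.lookup xs j → i ≡ j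
  lookup-injective (_    ∷ _)    {zero}  {zero}  _  = refl
  lookup-injective (x∉xs ∷ _)    {zero}  {suc j} eq = contradiction eq (All.lookup x∉xs (∈-lookup j))
  lookup-injective (x∉xs ∷ _)    {suc i} {zero}  eq = contradiction (sym eq) (All.lookup x∉xs (∈-lookup i))
  lookup-injective (_    ∷ uniq) {suc i} {suc j} eq = cong suc (lookup-injective uniq eq)

  module _ {h N : ℕ} (H : Graph (Fin h)) (G : Graph (Fin N)) (V : Fin h → Subset N) where

    open Canonical H Fin._≟_ G

    #canonicalCopies≡#canonical : #canonicalCopies H G V ≡ #canonical (elements ∘ V)
    #canonicalCopies≡#canonical = begin
      #canonicalCopies H G V                                                ≡⟨ length-filter≡∑ (isCanonicalCopy? H G V) (tuples h (allFin N)) ⟩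
      ∑ (tuples h (allFin N)) (λ x → ι (isCanonicalCopy? H G V x))          ≡⟨ cong (λ xs → ∑ xs (λ x → ι (isCanonicalCopy? H G V x))) (tuples≡box h (allFin N)) ⟩
      ∑ (box {h = h} (const (allFin N))) (λ x → ι (isCanonicalCopy? H G V x))
        ≡⟨ ∑-cong (box {h = h} (const (allFin N))) (λ {x} _ → ι-× (Fin.all? λ i → lookup x i Subset.∈? V i) (canonical? x) (isCanonicalCopy? H G V x) _,_ id) ⟨
      ∑ (box {h = h} (const (allFin N))) (λ x → ι (Fin.all? λ i → lookup x i Subset.∈? V i) * ι (canonical? x))
        ≡⟨ ∑-box-filter {h = h} (const (allFin N)) (λ i → Subset._∈? V i) (λ x → ι (canonical? x)) ⟨
      #canonical (elements ∘ V)                                             ∎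
      where open ≡-Reasoning

    length-box-elements : length (box (elements ∘ V)) ≡ product (tabulate (λ i → ∣ V i ∣))
    length-box-elements = trans (length-box (elements ∘ V)) (cong product (tabulate-cong (length-elements ∘ V)))

    module _ {k : ℕ} (B : Blowup H Fin._≟_ G (elements ∘ V) (allFin h) k) where
      open Blowup B

      blowup-subsets : Σ[ W ∈ (Fin h → Subset N) ]
        (∀ i → W i Subset.⊆ V i) × (∀ i → ∣ W i ∣ ≡ k) ×
        (∀ i j → Adj H i j → ∀ {u v} → u Subset.∈ W i → v Subset.∈ W j → Adj G u v)
      blowup-subsets = fromElements ∘ part
        , (λ i u∈ → ∈-elements⁻ (part⊆ i (∈-fromElements⁻ u∈)))
        , (λ i → trans (∣fromElements∣ (unique i)) (size (∈-allFin i)))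
        , (λ i j ij u∈ v∈ → complete (∈-allFin i) (∈-allFin j) ij (∈-fromElements⁻ u∈) (∈-fromElements⁻ v∈))

      -- Injectivity holds within a part because its list has no repetitions, and between parts
      -- because the sets `V i` are disjoint.
      blowup-⊑ : (∀ i j → i ≢ j → Subset.Empty (V i Subset.∩ V j)) → (H [ k ]) ⊑ G
      blowup-⊑ disjoint = f , f-injective _ _
        , (λ { {i , a} {j , b} ij → complete (∈-allFin i) (∈-allFin j) ij (∈-lookup (index i a)) (∈-lookup (index j b)) })
        where
        index : ∀ i → Fin k → Fin (length (part i))
        index i = Fin.cast (sym (size (∈-allFin i)))
        f : Fin h × Fin k → Fin N
        f (i , a) = List.lookup (part i) (index i a)
        f∈V : ∀ i a → f (i , a) Subset.∈ V i
        f∈V i a = ∈-elements⁻ (part⊆ i (∈-lookup (index i a)))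
        index-injective : ∀ i {a b} → index i a ≡ index i b → a ≡ b
        index-injective i {a} {b} eq = Fin.toℕ-injective
          (trans (sym (Fin.toℕ-cast _ a)) (trans (cong Fin.toℕ eq) (Fin.toℕ-cast _ b)))
        f-injective : ∀ x y → f x ≡ f y → x ≡ y
        f-injective (i , a) (j , b) eq with i Fin.≟ j
        ... | yes refl = cong (i ,_) (index-injective i (lookup-injective (unique i) eq))
        ... | no  i≢j  = contradiction (f (i , a) , Subset.x∈p∩q⁺ (f∈V i a , subst (Subset._∈ V j) (sym eq) (f∈V j b))) (disjoint i j i≢j)

-- Natural numbers, powers and reciprocals in the rationals.

module Rationals where

  open import Defs using (_^_; 2^_)
  open import Algebra.Bundles using (CommutativeMonoid)
  import Algebra.Properties.CommutativeSemigroup as CommutativeSemigroup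
  open import Data.Integer as ℤ using (+_; -[1+_])
  import Data.Integer.Properties as ℤ
  import Data.Nat.Coprimality as Coprimality
  open import Data.Rational
  open import Data.Rational.Properties

  open CommutativeSemigroup (CommutativeMonoid.commutativeSemigroup *-1-commutativeMonoid) using (interchange)

  nat : ℕ → ℚ
  nat n = + n / 1

  -- The normalisation in `+ n / 1` is stuck on a gcd for variable `n`; the literal fraction exposes
  -- numerator and denominator.
  nat≡ : ∀ n → nat n ≡ mkℚ (+ n) 0 (Coprimality.sym (Coprimality.1-coprimeTo n))
  nat≡ n = normalize-coprime (Coprimality.sym (Coprimality.1-coprimeTo n))

  ↥<⇒<nat : ∀ q M → ↥ q ℤ.< + (M ℕ.* ↧ₙ q) → q < nat M
  ↥<⇒<nat q M ↥q< = subst (q <_) (sym (nat≡ M))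
    (*<* (subst₂ ℤ._<_ (sym (ℤ.*-identityʳ (↥ q))) (ℤ.pos-* M (↧ₙ q)) ↥q<))

  <↥⇒nat< : ∀ q M → + (M ℕ.* ↧ₙ q) ℤ.< ↥ q → nat M < q
  <↥⇒nat< q M <↥q = subst (_< q) (sym (nat≡ M))
    (*<* (subst₂ ℤ._<_ (ℤ.pos-* M (↧ₙ q)) (sym (ℤ.*-identityʳ (↥ q))) <↥q))

  nat-mono-< : ∀ {m n} → m ℕ.< n → nat m < nat n
  nat-mono-< {m} {n} m<n = subst (_< nat n) (sym (nat≡ m))
    (↥<⇒<nat _ n (ℤ.+<+ (subst (m ℕ.<_) (sym (ℕ.*-identityʳ n)) m<n)))

  nat-mono-≤ : ∀ {m n} → m ℕ.≤ n → nat m ≤ nat n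
  nat-mono-≤ {m} {n} m≤n with m ℕ.≟ n
  ... | yes refl = ≤-refl
  ... | no  m≢n  = <⇒≤ (nat-mono-< (ℕ.≤∧≢⇒< m≤n m≢n))

  nat-cancel-< : ∀ {m n} → nat m < nat n → m ℕ.< n
  nat-cancel-< {m} {n} m<n = ℕ.≰⇒> λ n≤m → <-irrefl refl (<-≤-trans m<n (nat-mono-≤ {n} {m} n≤m))

  0≤nat : ∀ n → 0ℚ ≤ nat n
  0≤nat n = nat-mono-≤ {0} {n} ℕ.z≤n

  nat-* : ∀ m n → nat (m ℕ.* n) ≡ nat m * nat n
  nat-* m n rewrite nat≡ m | nat≡ n = cong (_/ 1) (ℤ.pos-* m n)

  *-mono-≤ : ∀ {a b c d} → 0ℚ ≤ c → 0ℚ ≤ b → a ≤ b → c ≤ d → a * c ≤ b * d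
  *-mono-≤ {a} {b} {c} {d} 0≤c 0≤b a≤b c≤d =
    ≤-trans (*-monoʳ-≤-nonNeg c {{nonNegative 0≤c}} a≤b) (*-monoˡ-≤-nonNeg b {{nonNegative 0≤b}} c≤d)

  0≤* : ∀ {a b} → 0ℚ ≤ a → 0ℚ ≤ b → 0ℚ ≤ a * b
  0≤* {a} {b} 0≤a 0≤b = subst (_≤ a * b) (*-zeroˡ 0ℚ) (*-mono-≤ ≤-refl 0≤a 0≤a 0≤b)

  0≤^ : ∀ {a} t → 0ℚ ≤ a → 0ℚ ≤ a ^ t
  0≤^ zero    0≤a = nat-mono-≤ {0} {1} ℕ.z≤n
  0≤^ (suc t) 0≤a = 0≤* 0≤a (0≤^ t 0≤a)

  ^-mono-≤ : ∀ {a b} t → 0ℚ ≤ a → a ≤ b → a ^ t ≤ b ^ t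
  ^-mono-≤ zero    0≤a a≤b = ≤-refl
  ^-mono-≤ (suc t) 0≤a a≤b = *-mono-≤ (0≤^ t 0≤a) (≤-trans 0≤a a≤b) a≤b (^-mono-≤ t 0≤a a≤b)

  nat-^ : ∀ m t → nat m ^ t ≡ nat (m ℕ.^ t)
  nat-^ m zero    = refl
  nat-^ m (suc t) = trans (cong (nat m *_) (nat-^ m t)) (sym (nat-* m (m ℕ.^ t)))

  0<½^ : ∀ m → 0ℚ < ½ ^ m
  0<½^ zero    = nat-mono-< {0} {1} ℕ.z<s
  0<½^ (suc m) = subst (_< ½ * ½ ^ m) (*-zeroʳ ½) (*-monoʳ-<-pos ½ (0<½^ m))

  ½^*2^≡1 : ∀ m → ½ ^ m * nat (2 ℕ.^ m) ≡ 1ℚ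
  ½^*2^≡1 zero    = refl
  ½^*2^≡1 (suc m) = begin
    ½ * ½ ^ m * nat (2 ℕ.* 2 ℕ.^ m)          ≡⟨ cong (½ * ½ ^ m *_) (nat-* 2 (2 ℕ.^ m)) ⟩
    ½ * ½ ^ m * (nat 2 * nat (2 ℕ.^ m))      ≡⟨ interchange ½ (½ ^ m) (nat 2) (nat (2 ℕ.^ m)) ⟩
    ½ * nat 2 * (½ ^ m * nat (2 ℕ.^ m))      ≡⟨ cong (1ℚ *_) (½^*2^≡1 m) ⟩
    1ℚ ∎
    where open ≡-Reasoning

  ½^-decreasing : ∀ m → ½ ^ suc m < ½ ^ m
  ½^-decreasing m = subst (½ * ½ ^ m <_) (*-identityˡ (½ ^ m))
    (*-monoˡ-<-pos (½ ^ m) {{positive (0<½^ m)}} {½} {1ℚ} (*<* (ℤ.+<+ (ℕ.s≤s ℕ.z<s))))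

  ½^≤1 : ∀ m → ½ ^ m ≤ 1ℚ
  ½^≤1 zero    = ≤-refl
  ½^≤1 (suc m) = ≤-trans (<⇒≤ (½^-decreasing m)) (½^≤1 m)

  2^-cancel-< : ∀ s E → 2^ s < nat (2 ℕ.^ E) → s ℤ.< + E
  2^-cancel-< -[1+ _ ] E _  = ℤ.-<+
  2^-cancel-< (+ s)    E lt = ℤ.+<+ (ℕ.≰⇒> λ E≤s → ℕ.<⇒≱
    (nat-cancel-< {2 ℕ.^ s} {2 ℕ.^ E} (subst (_< nat (2 ℕ.^ E)) (nat-^ 2 s) lt)) (ℕ.^-monoʳ-≤ 2 E≤s))

  2^-cancel-> : ∀ s E → nat (2 ℕ.^ E) < 2^ s → + E ℤ.< s
  2^-cancel-> -[1+ n ] E lt = contradiction (<-≤-trans lt (½^≤1 (suc n)))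
    (λ 2^E<1 → <-irrefl refl (<-≤-trans 2^E<1 (nat-mono-≤ {1} {2 ℕ.^ E} (ℕ.m^n>0 2 E))))
  2^-cancel-> (+ s)    E lt = ℤ.+<+ (ℕ.≰⇒> λ s≤E → ℕ.<⇒≱
    (nat-cancel-< {2 ℕ.^ E} {2 ℕ.^ s} (subst (nat (2 ℕ.^ E) <_) (nat-^ 2 s) lt)) (ℕ.^-monoʳ-≤ 2 s≤E))

  recip : ∀ n → .{{ℕ.NonZero n}} → ℚ
  recip (suc n) = mkℚ (+ 1) n (Coprimality.1-coprimeTo (suc n))

  recip-inverse : ∀ n .{{_ : ℕ.NonZero n}} → recip n * nat n ≡ 1ℚ
  recip-inverse (suc n) = trans (cong (recip (suc n) *_) (nat≡ (suc n)))
    (*-inverseˡ (mkℚ (+ suc n) 0 (Coprimality.sym (Coprimality.1-coprimeTo (suc n)))))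

  0<recip : ∀ n .{{_ : ℕ.NonZero n}} → 0ℚ < recip n
  0<recip (suc n) = *<* (ℤ.+<+ ℕ.z<s)

-- Estimates for cuts, and the passage from γ to powers of 2.

module Cuts where

  open import Defs
  open Counting using (n<2^n)
  open Rationals
  open import Data.Integer as ℤ using (+_; -[1+_])
  open import Data.Rational as ℚ using (ℚ; 0ℚ; 1ℚ; ½; mkℚ; *<*; *≤*)
  import Data.Rational.Properties as ℚ

  fromℚ-isReal : ∀ p → IsReal (fromℚ p)
  fromℚ-isReal p = record
    { inhabitedˡ = p ℚ.- 1ℚ , subst (p ℚ.- 1ℚ ℚ.<_) (ℚ.+-identityʳ p) (ℚ.+-monoʳ-< p {ℚ.- 1ℚ} {0ℚ} (*<* ℤ.-<+))
    ; inhabitedᵘ = p ℚ.+ 1ℚ , subst (ℚ._< p ℚ.+ 1ℚ) (ℚ.+-identityʳ p) (ℚ.+-monoʳ-< p {0ℚ} {1ℚ} (*<* (ℤ.+<+ ℕ.z<s)))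
    ; closedˡ    = λ q<r r<p → ℚ.<-trans q<r r<p
    ; closedᵘ    = λ q<r p<q → ℚ.<-trans p<q q<r
    ; openˡ      = λ q<p → ℚ.<-dense q<p
    ; openᵘ      = λ p<r → let q , p<q , q<r = ℚ.<-dense p<r in q , q<r , p<q
    ; disjoint   = λ (q<p , p<q) → ℚ.<-asym q<p p<q
    ; located    = located
    }
    where
    located : ∀ {q r} → q ℚ.< r → q ℚ.< p ⊎ p ℚ.< r
    located {q} q<r with q ℚ.<? p
    ... | yes q<p = inj₁ q<p
    ... | no  q≮p = inj₂ (ℚ.≤-<-trans (ℚ.≮⇒≥ q≮p) q<r)

  -- This bound and the next each read one half of a cut, so they pass through `*`, `⁻¹` and `log₂`
  -- by unpacking a single witness.
  NonNegative : Cut → Set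
  NonNegative x = ∀ {q} → Upper x q → 0ℚ ℚ.≤ q

  _≤ℚ_ : Cut → ℚ → Set
  x ≤ℚ X = ∀ {q} → Lower x q → q ℚ.≤ X

  private
    *-nonPos : ∀ {a b} → a ℚ.< 0ℚ → 0ℚ ℚ.≤ b → a ℚ.* b ℚ.≤ 0ℚ
    *-nonPos {a} {b} a<0 0≤b = subst (a ℚ.* b ℚ.≤_) (ℚ.*-zeroˡ b)
      (ℚ.*-monoʳ-≤-nonNeg b {{ℚ.nonNegative 0≤b}} (ℚ.<⇒≤ a<0))

  *-nonNegative : ∀ x y → NonNegative x → NonNegative y → NonNegative (x * y)
  *-nonNegative x y 0≤x 0≤y (a , b , c , d , (_ , x<b , _ , y<d) , _ , _ , _ , bd<q) =
    ℚ.≤-trans (0≤* (0≤x x<b) (0≤y y<d)) (ℚ.<⇒≤ bd<q)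

  -- The lower endpoints `a` and `c` may be negative even though x and y are not. If `a` is
  -- negative, q < ad ≤ 0 suffices, and if `c` is, q < bc ≤ 0; otherwise ac ≤ XY.
  *-<ℚ : ∀ x y {X Y} → 0ℚ ℚ.≤ X → 0ℚ ℚ.≤ Y → NonNegative x → NonNegative y → x ≤ℚ X → y ≤ℚ Y →
         ∀ {q} → Lower (x * y) q → q ℚ.< X ℚ.* Y
  *-<ℚ x y 0≤X 0≤Y 0≤x 0≤y x≤X y≤Y (a , b , c , d , (a<x , x<b , c<y , y<d) , q<ac , q<ad , q<bc , q<bd)
    with a ℚ.<? 0ℚ | c ℚ.<? 0ℚ
  ... | yes a<0 | _       = ℚ.<-≤-trans q<ad (ℚ.≤-trans (*-nonPos a<0 (0≤y y<d)) (0≤* 0≤X 0≤Y))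
  ... | no  _   | yes c<0 = ℚ.<-≤-trans (subst (_ ℚ.<_) (ℚ.*-comm b c) q<bc)
                                        (ℚ.≤-trans (*-nonPos c<0 (0≤x x<b)) (0≤* 0≤X 0≤Y))
  ... | no  _   | no  c≮0 = ℚ.<-≤-trans q<ac (*-mono-≤ (ℚ.≮⇒≥ c≮0) 0≤X (x≤X a<x) (y≤Y c<y))

  log₂-nonNegative : ∀ n → 0 ℕ.< n → NonNegative (log₂ (fromℕ n))
  log₂-nonNegative n 0<n {q} (b , n<b , b^t<2^s) = ℚ.<⇒≤ (<↥⇒nat< q 0 (2^-cancel-> (ℚ.↥ q) 0 (ℚ.≤-<-trans 1≤b^t b^t<2^s)))
    where
    1≤b^t : nat 1 ℚ.≤ b ^ ℚ.↧ₙ q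
    1≤b^t = subst (ℚ._≤ b ^ ℚ.↧ₙ q) (trans (nat-^ 1 (ℚ.↧ₙ q)) (cong nat (ℕ.^-zeroˡ (ℚ.↧ₙ q))))
      (^-mono-≤ (ℚ.↧ₙ q) (0≤nat 1) (ℚ.≤-trans (nat-mono-≤ {1} {n} 0<n) (ℚ.<⇒≤ n<b)))

  log₂-≤ℚ : ∀ n M → n ℕ.< 2 ℕ.^ M → log₂ (fromℕ n) ≤ℚ nat M
  log₂-≤ℚ n M n<2^M {q} (a , a<n , 0<a , 2^s<a^t) = ℚ.<⇒≤ (↥<⇒<nat q M (2^-cancel-< (ℚ.↥ q) (M ℕ.* t)
    (ℚ.<-≤-trans 2^s<a^t (subst (a ^ t ℚ.≤_) (trans (nat-^ (2 ℕ.^ M) t) (cong nat (ℕ.^-*-assoc 2 M t)))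
      (^-mono-≤ t (ℚ.<⇒≤ 0<a) (ℚ.≤-trans (ℚ.<⇒≤ a<n) (nat-mono-≤ (ℕ.<⇒≤ n<2^M))))))))
    where t = ℚ.↧ₙ q

  -- A `b` above 1/γ satisfies 1 < bc for some c < γ, and c ≤ 2^-m forces 2^m ≤ b. Then 2^(mt) ≤ b^t
  -- < 2^s gives m < s/t = d.
  log₂⁻¹-bound : ∀ γ m → γ ≤ℚ (½ ^ m) → ∀ {d} → Upper (log₂ (γ ⁻¹)) d → nat m ℚ.< d
  log₂⁻¹-bound γ m γ≤ {d} (b , (c , c<γ , 0<c , 1<bc) , b^t<2^s) = <↥⇒nat< d m (2^-cancel-> (ℚ.↥ d) (m ℕ.* t)
    (ℚ.≤-<-trans (subst (ℚ._≤ b ^ t) (trans (nat-^ (2 ℕ.^ m) t) (cong nat (ℕ.^-*-assoc 2 m t)))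
      (^-mono-≤ t (0≤nat (2 ℕ.^ m)) 2^m≤b)) b^t<2^s))
    where
    t = ℚ.↧ₙ d
    2^m≤b : nat (2 ℕ.^ m) ℚ.≤ b
    2^m≤b = ℚ.≮⇒≥ λ b<2^m → ℚ.<-irrefl refl (ℚ.<-≤-trans 1<bc (ℚ.≤-trans
      (*-mono-≤ (ℚ.<⇒≤ 0<c) (0≤nat (2 ℕ.^ m)) (ℚ.<⇒≤ b<2^m) (γ≤ c<γ))
      (ℚ.≤-reflexive (trans (ℚ.*-comm (nat (2 ℕ.^ m)) (½ ^ m)) (½^*2^≡1 m)))))

  ⁻¹-nonNegative : ∀ y → NonNegative (y ⁻¹)
  ⁻¹-nonNegative y {q} (c , _ , 0<c , 1<qc) = ℚ.≮⇒≥ λ q<0 → ℚ.<-irrefl refl (ℚ.<-trans 1<qc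
    (ℚ.≤-<-trans (*-nonPos q<0 (ℚ.<⇒≤ 0<c)) (*<* (ℤ.+<+ ℕ.z<s))))

  ⁻¹-≤ℚ : ∀ y m .{{_ : ℕ.NonZero m}} → (∀ {d} → Upper y d → nat m ℚ.< d) → (y ⁻¹) ≤ℚ recip m
  ⁻¹-≤ℚ y m m<y {c} (d , y<d , cd<1) with c ℚ.<? 0ℚ
  ... | yes c<0 = ℚ.≤-trans (ℚ.<⇒≤ c<0) (ℚ.<⇒≤ (0<recip m))
  ... | no  c≮0 = ℚ.≮⇒≥ λ r<c → ℚ.<-irrefl refl (ℚ.≤-<-trans (begin
      1ℚ                     ≡⟨ recip-inverse m ⟨
      recip m ℚ.* nat m      ≤⟨ *-mono-≤ (0≤nat m) (ℚ.≮⇒≥ c≮0) (ℚ.<⇒≤ r<c) (ℚ.<⇒≤ (m<y y<d)) ⟩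
      c ℚ.* d                ∎) cd<1)
    where open ℚ.≤-Reasoning

  archimedean : ∀ {q} → 0ℚ ℚ.< q → ∃[ t ] ½ ^ t ℚ.< q
  archimedean {mkℚ (+ zero)  _ _} 0<q@(*<* (ℤ.+<+ ()))
  archimedean {mkℚ -[1+ _ ] _ _} (*<* ())
  archimedean {q@(mkℚ (+ suc s) d _)} _ = t , ℚ.*-cancelʳ-<-nonNeg (nat (2 ℕ.^ t)) {{ℚ.nonNegative (0≤nat (2 ℕ.^ t))}} (begin-strict
      ½ ^ t ℚ.* nat (2 ℕ.^ t)           ≡⟨ ½^*2^≡1 t ⟩
      1ℚ                                ≡⟨ recip-inverse t ⟨
      recip t ℚ.* nat t                 <⟨ ℚ.*-monoʳ-<-pos (recip t) {{ℚ.positive (0<recip t)}} (nat-mono-< (n<2^n t)) ⟩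
      recip t ℚ.* nat (2 ℕ.^ t)         ≤⟨ ℚ.*-monoʳ-≤-nonNeg (nat (2 ℕ.^ t)) {{ℚ.nonNegative (0≤nat (2 ℕ.^ t))}} recip≤q ⟩
      q ℚ.* nat (2 ℕ.^ t)               ∎)
    where
    open ℚ.≤-Reasoning
    -- The denominator of `q`, so that q ≥ 1/t > 2^-t.
    t = suc d
    recip≤q : recip t ℚ.≤ q
    recip≤q = *≤* (ℤ.+≤+ (ℕ.+-monoʳ-≤ t ℕ.z≤n))

  -- Locatedness can only separate γ from two distinct rationals. Each step tests 2^-(m+2) against
  -- 2^-(m+1), so the final window has ratio 4 rather than 2. The search ends because 2^-m would
  -- drop below `q₀`, which lies below γ.
  dyadic-scale : ∀ γ → IsReal γ → fromℚ 0ℚ < γ → γ ≤ fromℚ ½ →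
                 ∃[ m ] 0 ℕ.< m × γ ≤ℚ (½ ^ m) × Lower γ (½ ^ (2 ℕ.+ m))
  dyadic-scale γ γ-real (q₀ , 0<q₀ , q₀<γ) γ≤½ with t , ½^t<q₀ ← archimedean 0<q₀ =
    search t 1 ℕ.z<s (λ q<γ → ℚ.<⇒≤ (γ≤½ _ q<γ)) (subst (λ e → ½ ^ e ℚ.< q₀) (ℕ.+-comm 1 t) (ℚ.<-trans (½^-decreasing t) ½^t<q₀))
    where
    open IsReal γ-real
    search : ∀ fuel m → 0 ℕ.< m → γ ≤ℚ (½ ^ m) → ½ ^ (fuel ℕ.+ m) ℚ.< q₀ →
             ∃[ m ] 0 ℕ.< m × γ ≤ℚ (½ ^ m) × Lower γ (½ ^ (2 ℕ.+ m))
    search zero       m 0<m γ≤ small = contradiction (ℚ.<-≤-trans small (γ≤ q₀<γ)) (ℚ.<-irrefl refl)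
    search (suc fuel) m 0<m γ≤ small with located (½^-decreasing (suc m))
    ... | inj₁ above = m , 0<m , γ≤ , above
    ... | inj₂ below = search fuel (suc m) ℕ.z<s
      (λ {q} q<γ → ℚ.≮⇒≥ λ ½^<q → disjoint (closedˡ ½^<q q<γ , below))
      (subst (λ e → ½ ^ e ℚ.< q₀) (sym (ℕ.+-suc fuel m)) small)

  -- γ is bounded below by 2^-(m+2). The two further factors ½ make room for the strict inequalities
  -- of the product cut: one puts `c` below `P`, the other puts the tested rational below ac.
  density : ∀ γ → IsReal γ → γ ≤ fromℚ ½ → ∀ m → Lower γ (½ ^ (2 ℕ.+ m)) → ∀ P # →
            γ * fromℕ P ≤ fromℕ # → P ℕ.≤ 2 ℕ.^ (4 ℕ.+ m) ℕ.* #
  density γ γ-real γ≤½ m a<γ zero      # γP≤# = ℕ.z≤n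
  density γ γ-real γ≤½ m a<γ P@(suc _) # γP≤# = ℕ.<⇒≤ (nat-cancel-< {P} {2 ℕ.^ (4 ℕ.+ m) ℕ.* #} (begin-strict
      nat P                                ≡⟨ ℚ.*-identityˡ (nat P) ⟨
      1ℚ ℚ.* nat P                         ≡⟨ cong (ℚ._* nat P) (trans (ℚ.*-comm (nat E) (½ ^ (4 ℕ.+ m))) (½^*2^≡1 (4 ℕ.+ m))) ⟨
      nat E ℚ.* ½ ^ (4 ℕ.+ m) ℚ.* nat P    ≡⟨ ℚ.*-assoc (nat E) (½ ^ (4 ℕ.+ m)) (nat P) ⟩
      nat E ℚ.* (½ ^ (4 ℕ.+ m) ℚ.* nat P)  <⟨ ℚ.*-monoʳ-<-pos (nat E) {{ℚ.positive (nat-mono-< {0} {E} (ℕ.m^n>0 2 (4 ℕ.+ m)))}} q<# ⟩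
      nat E ℚ.* nat #                      ≡⟨ nat-* E # ⟨
      nat (E ℕ.* #)                        ∎))
    where
    open ℚ.≤-Reasoning
    open IsReal γ-real
    E = 2 ℕ.^ (4 ℕ.+ m)
    a c : ℚ
    a = ½ ^ (2 ℕ.+ m)
    c = ½ ℚ.* nat P
    0<P : 0ℚ ℚ.< nat P
    0<P = nat-mono-< {0} {P} ℕ.z<s
    c<P : c ℚ.< nat P
    c<P = subst (c ℚ.<_) (ℚ.*-identityˡ (nat P)) (ℚ.*-monoˡ-<-pos (nat P) {{ℚ.positive 0<P}} {½} {1ℚ} (*<* (ℤ.+<+ (ℕ.s≤s ℕ.z<s))))
    0≤c : 0ℚ ℚ.≤ c
    0≤c = 0≤* {½} (*≤* (ℤ.+≤+ ℕ.z≤n)) (0≤nat P)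
    γ<1 : Upper γ 1ℚ
    γ<1 with located {½} {1ℚ} (*<* (ℤ.+<+ (ℕ.s≤s ℕ.z<s)))
    ... | inj₁ ½<γ = contradiction (γ≤½ ½ ½<γ) (ℚ.<-irrefl refl)
    ... | inj₂ γ<1 = γ<1
    q<ac : ½ ^ (4 ℕ.+ m) ℚ.* nat P ℚ.< a ℚ.* c
    q<ac = subst (½ ^ (4 ℕ.+ m) ℚ.* nat P ℚ.<_)
      (trans (cong (ℚ._* nat P) (ℚ.*-comm ½ a)) (ℚ.*-assoc a ½ (nat P)))
      (ℚ.*-monoˡ-<-pos (nat P) {{ℚ.positive 0<P}} (½^-decreasing (3 ℕ.+ m)))
    P<1+P : nat P ℚ.< nat (suc P)
    P<1+P = nat-mono-< {P} {suc P} (ℕ.n<1+n P)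
    c≤d : c ℚ.≤ nat (suc P)
    c≤d = ℚ.<⇒≤ (ℚ.<-trans c<P P<1+P)
    a≤1 : a ℚ.≤ 1ℚ
    a≤1 = ½^≤1 (2 ℕ.+ m)
    0≤1 : 0ℚ ℚ.≤ 1ℚ
    0≤1 = 0≤nat 1
    q<# : ½ ^ (4 ℕ.+ m) ℚ.* nat P ℚ.< nat #
    q<# = γP≤# _ (a , 1ℚ , c , nat (suc P) , (a<γ , γ<1 , c<P , P<1+P) , q<ac
      , ℚ.<-≤-trans q<ac (*-mono-≤ 0≤c (ℚ.<⇒≤ (0<½^ (2 ℕ.+ m))) ℚ.≤-refl c≤d)
      , ℚ.<-≤-trans q<ac (*-mono-≤ 0≤c 0≤1 a≤1 ℚ.≤-refl)
      , ℚ.<-≤-trans q<ac (*-mono-≤ 0≤c 0≤1 a≤1 c≤d))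

  -- log₂ (1/γ) ≥ m and log₂ n ≤ 2k·C·(4 + m) ≤ 10k·C·m.
  ratio-bound : ∀ C .{{_ : ℕ.NonZero C}} γ m → 0 ℕ.< m → γ ≤ℚ (½ ^ m) → ∀ n → 0 ℕ.< n → ∀ k →
    n ℕ.< 2 ℕ.^ (2 ℕ.* k ℕ.* (C ℕ.* (4 ℕ.+ m))) →
    fromℚ (recip (10 ℕ.* C) {{ℕ.m*n≢0 10 C}}) * log₂ (fromℕ n) / log₂ (γ ⁻¹) ≤ fromℕ k
  ratio-bound C γ m@(suc _) _ γ≤ n 0<n k n<2^M q q<ratio = ℚ.<-≤-trans
    (*-<ℚ (fromℚ β * log₂ (fromℕ n)) (log₂ (γ ⁻¹) ⁻¹) (0≤* 0≤β (0≤nat M)) (ℚ.<⇒≤ (0<recip m))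
      (*-nonNegative (fromℚ β) (log₂ (fromℕ n)) β-nonNegative (log₂-nonNegative n 0<n))
      (⁻¹-nonNegative (log₂ (γ ⁻¹)))
      (λ q< → ℚ.<⇒≤ (*-<ℚ (fromℚ β) (log₂ (fromℕ n)) 0≤β (0≤nat M) β-nonNegative (log₂-nonNegative n 0<n)
                ℚ.<⇒≤ (log₂-≤ℚ n M n<2^M) q<))
      (⁻¹-≤ℚ (log₂ (γ ⁻¹)) m (log₂⁻¹-bound γ m γ≤)) q<ratio)
    (begin
      β ℚ.* nat M ℚ.* recip m                                       ≤⟨ ℚ.*-monoʳ-≤-nonNeg (recip m) {{ℚ.nonNegative (ℚ.<⇒≤ (0<recip m))}}
                                                                         (ℚ.*-monoˡ-≤-nonNeg β {{ℚ.nonNegative 0≤β}} (nat-mono-≤ {M} M≤)) ⟩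
      β ℚ.* nat (10 ℕ.* C ℕ.* (k ℕ.* m)) ℚ.* recip m                 ≡⟨ cong (λ z → β ℚ.* z ℚ.* recip m) (nat-* (10 ℕ.* C) (k ℕ.* m)) ⟩
      β ℚ.* (nat (10 ℕ.* C) ℚ.* nat (k ℕ.* m)) ℚ.* recip m           ≡⟨ cong (ℚ._* recip m) (ℚ.*-assoc β (nat (10 ℕ.* C)) _) ⟨
      β ℚ.* nat (10 ℕ.* C) ℚ.* nat (k ℕ.* m) ℚ.* recip m             ≡⟨ cong (λ z → z ℚ.* nat (k ℕ.* m) ℚ.* recip m) (recip-inverse (10 ℕ.* C) {{ℕ.m*n≢0 10 C}}) ⟩
      1ℚ ℚ.* nat (k ℕ.* m) ℚ.* recip m                               ≡⟨ cong (ℚ._* recip m) (trans (ℚ.*-identityˡ _) (nat-* k m)) ⟩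
      nat k ℚ.* nat m ℚ.* recip m                                   ≡⟨ ℚ.*-assoc (nat k) (nat m) (recip m) ⟩
      nat k ℚ.* (nat m ℚ.* recip m)                                 ≡⟨ cong (nat k ℚ.*_) (trans (ℚ.*-comm (nat m) (recip m)) (recip-inverse m)) ⟩
      nat k ℚ.* 1ℚ                                                  ≡⟨ ℚ.*-identityʳ (nat k) ⟩
      nat k                                                         ∎)
    where
    open ℚ.≤-Reasoning
    M = 2 ℕ.* k ℕ.* (C ℕ.* (4 ℕ.+ m))
    β = recip (10 ℕ.* C) {{ℕ.m*n≢0 10 C}}
    0≤β : 0ℚ ℚ.≤ β
    0≤β = ℚ.<⇒≤ (0<recip (10 ℕ.* C) {{ℕ.m*n≢0 10 C}})
    β-nonNegative : NonNegative (fromℚ β)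
    β-nonNegative β<q = ℚ.≤-trans 0≤β (ℚ.<⇒≤ β<q)
    M≤ : M ℕ.≤ 10 ℕ.* C ℕ.* (k ℕ.* m)
    M≤ = ℕ.≤-trans (ℕ.*-monoʳ-≤ (2 ℕ.* k) (ℕ.*-monoʳ-≤ C (ℕ.+-monoˡ-≤ m (ℕ.*-monoʳ-≤ 4 {1} {m} (ℕ.s≤s ℕ.z≤n)))))
           (ℕ.≤-reflexive (collect k C m))
      where
      collect : ∀ k C m → 2 ℕ.* k ℕ.* (C ℕ.* (4 ℕ.* m ℕ.+ m)) ≡ 10 ℕ.* C ℕ.* (k ℕ.* m)
      collect = solve-∀

open Blowups
open Rationals using (recip; 0<recip)
open Cuts
open import Defs
open import Data.Fin.Subset using (Subset; _∈_; _⊆_; ∣_∣)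
open import Data.Rational using (0ℚ; ½)
import Data.Rational.Properties as ℚ

theorem3p3 : ∀ {h : ℕ} (H : Graph (Fin h)) → TriangleFree H →
    ∃[ β ] IsReal β × fromℚ 0ℚ < β ×
    (∀ (γ : Cut) → IsReal γ → fromℚ 0ℚ < γ → γ ≤ fromℚ ½ →
    ∀ (n : ℕ) → 0 ℕ.< n →
    ∀ {N : ℕ} (G : Graph (Fin N)) (V : Fin h → Subset N) → IsInflation γ n H G V →
    ∃[ k ] 0 ℕ.< k ×
    β * log₂ (fromℕ n) / log₂ (γ ⁻¹) ≤ fromℕ k ×
    (Σ[ W ∈ (Fin h → Subset N) ]
    (∀ i → W i ⊆ V i) × (∀ i → ∣ W i ∣ ≡ k) ×
    (∀ i j → Adj H i j → ∀ {u v} → u ∈ W i → v ∈ W j → Adj G u v)) ×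
    (H [ k ]) ⊑ G)
-- Positivity of a cut asks for a rational strictly between 0 and `β`, hence density of the order.
theorem3p3 {h} H H-free = fromℚ β , fromℚ-isReal β , ℚ.<-dense (0<recip (10 ℕ.* C)) ,
  λ γ γ-real 0<γ γ≤½ n 0<n G V inflation →
    let open IsInflation inflation
        m , 0<m , γ≤ , <γ = dyadic-scale γ γ-real 0<γ γ≤½
        dense = density γ γ-real γ≤½ m <γ _ _ copies
        k , 0<k , n<2^ , B = blowup H Fin._≟_ G H-free (λ i → elements (V i)) (4 ℕ.+ m) n ℕ.z<s 0<n
          (λ i → elements-unique (V i)) (λ i → subst (n ℕ.≤_) (sym (length-elements (V i))) (large i))
          (subst₂ (λ P # → P ℕ.≤ 2 ℕ.^ (4 ℕ.+ m) ℕ.* #) (sym (length-box-elements H G V)) (#canonicalCopies≡#canonical H G V) dense)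
    in k , 0<k , ratio-bound C γ m 0<m γ≤ n 0<n k n<2^ , blowup-subsets H G V B , blowup-⊑ H G V B disjoint
  where
  C = exponent-const h
  β = recip (10 ℕ.* C)
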